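{- For every simple graph with $n$ vertices and $k\leq n$, $$I(\overline{K}_k)=\binom nk+\sum_{v=2}^{k}\ \sum_{e=\lceil v/2\rceil}^{\binom v2}(-1)^e\binom{n-v}{k-v}\sigma_e^v,$$ and $$I(K_k)=\sigma_{\binom k2}^k .$$
   Context: Graphs are finite and simple. $I(A)(\mathcal{G})$ is the number of (not necessarily induced) subgraphs of $\mathcal{G}$ isomorphic to $A$; $I(K_k)(\mathcal{G})$ is the number of cliques of order $k$ and $I(\overline{K}_k)(\mathcal{G})$ the number of independent sets of order $k$ in $\mathcal{G}$. $|A|$ is the number of edges of $A$ and $cv(A)$ the number of vertices of $A$ connected to its edges. For a graph $\mathcal{G}$, $$\sigma_e^v(\mathcal{G})=\sum_{A\subseteq\mathcal{G},\,cv(A)=v,\,|A|=e}I(A)(\mathcal{G}),$$ the sum being over unlabeled subgraphs (isomorphism classes, without isolated vertices) $A$. The identities are between functions of the graph on $n$ vertices.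
   Formalization: The identity for I(K_k) is stated for k ≠ 1 only: at k = 1 it fails for every graph with n ≥ 1 vertices, since no graph A without edges has cv(A) = 1, so σ_0^1 = 0, while I(K_1) = n. -}

module Defs where

open import Data.Bool.Base using (true; false)
open import Data.Fin.Base using (Fin; finToFun; funToFin)
open import Data.Fin.Properties using (_≟_; _<?_; any?; all?; finToFun-funToFin)
open import Data.Fin.Subset using (Subset; _∈_; ⊤; ∣_∣)
open import Data.Fin.Subset.Properties using (_∈?_)
open import Data.Integer.Base as ℤ using (ℤ)
open import Data.List.Base
  using (List; []; _∷_; [_]; _++_; map; filter; length; foldr; upTo; allFin;
         cartesianProduct; deduplicate)
open import Data.List.Membership.Propositional using () renaming (_∈_ to _∈ˡ_)
import Data.List.Membership.DecPropositional as DecMembership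
open import Data.List.Relation.Unary.All using (All) renaming (all? to allˡ?)
open import Data.Nat.Base using (ℕ; zero; suc; _+_; _∸_)
open import Data.Nat.ListAction using (sum)
import Data.Nat.Properties as ℕ
open import Data.Product.Base using (_×_; _,_; ∃; proj₁; proj₂; uncurry)
open import Data.Product.Properties using (≡-dec)
open import Data.Sum.Base using (_⊎_; swap)
open import Data.Vec.Base using () renaming (_∷_ to _∷ᵛ_; [] to []ᵛ)
open import Function.Base using (_∘_)
open import Function.Bundles using (_⇔_; mk⇔; Equivalence)
open import Level using (Level; 0ℓ)
open import Relation.Binary.Core using (Rel)
open import Relation.Binary.Definitions
  using (Decidable; Symmetric; Irreflexive; DecidableEquality)
open import Relation.Binary.PropositionalEquality
  using (_≡_; _≢_; sym; trans; subst; subst₂; _≗_)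
open import Relation.Nullary using (¬_; Dec)
open import Relation.Nullary.Decidable
  using (map′; ¬?; _×-dec_; _⊎-dec_; _→-dec_)
import Relation.Unary as U

private
  variable
    a p : Level
    m n : ℕ

count : {A : Set a} {P : U.Pred A p} → U.Decidable P → List A → ℕ
count P? xs = length (filter P? xs)

-- The sublists of a list, by position; for a duplicate-free list these are its
-- subsets, each listed once.
sublists : {A : Set a} → List A → List (List A)
sublists []       = [ [] ]
sublists (x ∷ xs) = sublists xs ++ map (x ∷_) (sublists xs)

subsets : (n : ℕ) → List (Subset n)
subsets zero    = [ []ᵛ ]
subsets (suc n) = map (false ∷ᵛ_) (subsets n) ++ map (true ∷ᵛ_) (subsets n)

-- Both bounds are inclusive; the sum is empty when hi < lo.
∑ : ℕ → ℕ → (ℕ → ℤ) → ℤ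
∑ lo hi f = foldr ℤ._+_ ℤ.0ℤ (map (λ i → f (lo + i)) (upTo (suc hi ∸ lo)))

infix 4 ∑
syntax ∑ lo hi (λ i → t) = ∑[ lo ≤ i ≤ hi ] t

record Graph (n : ℕ) : Set₁ where
  infix 4 _~_ _~?_
  field
    _~_         : Rel (Fin n) 0ℓ
    symmetric   : Symmetric _~_
    irreflexive : Irreflexive _≡_ _~_
    _~?_        : Decidable _~_

open Graph using () renaming (_~_ to adj; _~?_ to adj?)

pairs : (n : ℕ) → List (Fin n × Fin n)
pairs n = filter (uncurry _<?_) (cartesianProduct (allFin n) (allFin n))

-- An edge {i , j} is listed once, as the pair (i , j) with i < j.
edges : Graph n → List (Fin n × Fin n)
edges {n} G = filter (uncurry (adj? G)) (pairs n)

∣_∣ᴱ : Graph n → ℕ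
∣ G ∣ᴱ = length (edges G)

cv : Graph n → ℕ
cv {n} G = count (λ i → any? (λ j → adj? G i j)) (allFin n)

_≟ᴾ_ : DecidableEquality (Fin n × Fin n)
_≟ᴾ_ = ≡-dec _≟_ _≟_

fromEdges : List (Fin n × Fin n) → Graph n
fromEdges {n} E = record
  { _~_         = λ i j → i ≢ j × ((i , j) ∈ˡ E ⊎ (j , i) ∈ˡ E)
  ; symmetric   = λ (i≢j , e) → (i≢j ∘ sym) , swap e
  ; irreflexive = λ i≡j (i≢j , _) → i≢j i≡j
  ; _~?_        = λ i j → ¬? (i ≟ j) ×-dec ((i , j) ∈ᴱ? E ⊎-dec (j , i) ∈ᴱ? E)
  }
  where open DecMembership (_≟ᴾ_ {n}) using () renaming (_∈?_ to _∈ᴱ?_)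

graphs : (n : ℕ) → List (Graph n)
graphs n = map fromEdges (sublists (pairs n))

-- f is an isomorphism from A onto the graph with vertex set W and the
-- adjacency relation of H.
IsIso : Graph m → Subset n → Graph n → (Fin m → Fin n) → Set
IsIso A W H f =
    (∀ i → f i ∈ W)
  × (∀ x → x ∈ W → ∃ λ i → f i ≡ x)
  × (∀ i j → f i ≡ f j → i ≡ j)
  × (∀ i j → adj A i j ⇔ adj H (f i) (f j))

infix 4 _≅[_]_ _≅[_]?_ _≅_ _≅?_

_≅[_]_ : Graph m → Subset n → Graph n → Set
A ≅[ W ] H = ∃ (IsIso A W H)

_≅_ : Graph n → Graph n → Set
A ≅ B = A ≅[ ⊤ ] B

private
  isIso? : (A : Graph m) (W : Subset n) (H : Graph n) → U.Decidable (IsIso A W H)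
  isIso? A W H f =
          all? (λ i → f i ∈? W)
    ×-dec all? (λ x → (x ∈? W) →-dec any? (λ i → f i ≟ x))
    ×-dec all? (λ i → all? (λ j → (f i ≟ f j) →-dec (i ≟ j)))
    ×-dec all? (λ i → all? (λ j →
            adj? A i j ⇔-dec adj? H (f i) (f j)))
    where
    _⇔-dec_ : {P Q : Set} → Dec P → Dec Q → Dec (P ⇔ Q)
    p? ⇔-dec q? = map′ (λ (to , from) → mk⇔ to from)
                       (λ e → Equivalence.to e , Equivalence.from e)
                       ((p? →-dec q?) ×-dec (q? →-dec p?))

  isIso-resp : (A : Graph m) (W : Subset n) (H : Graph n) {f g : Fin m → Fin n} →
               f ≗ g → IsIso A W H f → IsIso A W H g
  isIso-resp A W H f≗g (into , onto , inj , pres) =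
      (λ i → subst (_∈ W) (f≗g i) (into i))
    , (λ x x∈W → proj₁ (onto x x∈W) , trans (sym (f≗g _)) (proj₂ (onto x x∈W)))
    , (λ i j gi≡gj → inj i j (trans (f≗g i) (trans gi≡gj (sym (f≗g j)))))
    , (λ i j → mk⇔
        (λ e → subst₂ (adj H) (f≗g i) (f≗g j) (Equivalence.to (pres i j) e))
        (λ e → Equivalence.from (pres i j)
                 (subst₂ (adj H) (sym (f≗g i)) (sym (f≗g j)) e)))

_≅[_]?_ : (A : Graph m) (W : Subset n) (H : Graph n) → Dec (A ≅[ W ] H)
A ≅[ W ]? H =
  map′ (λ (c , iso) → finToFun c , iso)
       (λ (f , iso) → funToFin f , isIso-resp A W H (sym ∘ finToFun-funToFin f) iso)
       (any? (λ c → isIso? A W H (finToFun c)))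

_≅?_ : Decidable (_≅_ {n})
A ≅? B = A ≅[ ⊤ ]? B

-- A subgraph of G is a set W of vertices together with a set E of edges of G
-- whose endpoints lie in W.
IsCopy : Graph m → Subset n × List (Fin n × Fin n) → Set
IsCopy A (W , E) = All (λ (i , j) → i ∈ W × j ∈ W) E × A ≅[ W ] fromEdges E

isCopy? : (A : Graph m) → U.Decidable (IsCopy {n = n} A)
isCopy? A (W , E) =
        allˡ? (λ (i , j) → (i ∈? W) ×-dec (j ∈? W)) E
  ×-dec (A ≅[ W ]? fromEdges E)

I : Graph m → Graph n → ℕ
I {n = n} A G = count (isCopy? A) (cartesianProduct (subsets n) (sublists (edges G)))

-- One representative of each isomorphism class of graphs without isolated
-- vertices that have v vertices and e edges; such a graph has a copy on the
-- vertex set Fin v, where having no isolated vertex means cv A ≡ v.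
classes : (v e : ℕ) → List (Graph v)
classes v e =
  deduplicate _≅?_ (filter (λ A → (cv A ℕ.≟ v) ×-dec (∣ A ∣ᴱ ℕ.≟ e)) (graphs v))

-- Classes that do not occur as subgraphs of G contribute 0.
σ : (v e : ℕ) → Graph n → ℕ
σ v e G = sum (map (λ A → I A G) (classes v e))

IsClique : Graph n → Subset n → Set
IsClique G S = ∀ i j → i ∈ S → j ∈ S → i ≢ j → adj G i j

isClique? : (G : Graph n) → U.Decidable (IsClique G)
isClique? G S = all? (λ i → all? (λ j →
  (i ∈? S) →-dec (j ∈? S) →-dec ¬? (i ≟ j) →-dec adj? G i j))

IsIndependent : Graph n → Subset n → Set
IsIndependent G S = ∀ i j → i ∈ S → j ∈ S → ¬ adj G i j

isIndependent? : (G : Graph n) → U.Decidable (IsIndependent G)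
isIndependent? G S = all? (λ i → all? (λ j →
  (i ∈? S) →-dec (j ∈? S) →-dec ¬? (adj? G i j)))

cliques : ℕ → Graph n → ℕ
cliques {n} k G = count (λ S → (∣ S ∣ ℕ.≟ k) ×-dec isClique? G S) (subsets n)

independentSets : ℕ → Graph n → ℕ
independentSets {n} k G =
  count (λ S → (∣ S ∣ ℕ.≟ k) ×-dec isIndependent? G S) (subsets n)

{-# OPTIONS --safe #-}

-- For a set E of edges let V(E) be the set of their endpoints. A copy (W , E)
-- of a graph without isolated vertices has W = V(E), and E determines the
-- isomorphism class, so σ v e G is the number of edge sets E ⊆ G with
-- |V(E)| = v and |E| = e. For the first identity, S is independent iff
-- Σ (-1)^|E| = 1 over the edge sets E inside S (the sum is 0 otherwise); summing
-- over S with |S| = k and exchanging the sums, E is weighted by the number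
-- C(n − v, k − v) of k-sets containing V(E). For the second, a clique S
-- corresponds to the edge set E of all pairs in S, characterised by |E| = C(k, 2);
-- V(E) = S holds unless |S| = 1.
module Submission where

open import Defs
open import Data.Bool.Base using (Bool; true; false; if_then_else_)
import Data.Bool.Properties as Bool
open import Data.Fin.Base as Fin using (Fin)
import Data.Fin.Properties as Fin
open import Data.Fin.Subset as Subset using (Subset; ∣_∣; ⁅_⁆; _∪_; ⊥)
  renaming (_∈_ to _∈ₛ_; _⊆_ to _⊆ₛ_)
open import Data.Fin.Subset.Properties as Subset using (_∈?_; _⊆?_)
open import Data.Integer.Base using (ℤ; +_; -1ℤ; 0ℤ; 1ℤ)
  renaming (_+_ to _+ᶻ_; _*_ to _*ᶻ_; _^_ to _^ᶻ_)
import Data.Integer.Properties as ℤ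
open import Data.Integer.Tactic.RingSolver using (solve-∀)
open import Data.List.Base
  using (List; []; _∷_; _++_; map; filter; length; foldr; upTo; allFin;
         cartesianProduct; deduplicate)
import Data.List.Membership.DecPropositional as DecMembership
open import Data.List.Membership.Propositional using (_∈_; lose; find)
open import Data.List.Membership.Propositional.Properties
import Data.List.Properties as List
open import Data.List.Relation.Binary.Sublist.Propositional using (_∷ʳ_; _∷_; [])
  renaming (_⊆_ to _⊑_; lookup to ⊑-lookup; ⊆-trans to ⊑-trans; minimum to ⊑-minimum)
open import Data.List.Relation.Binary.Sublist.Propositional.Properties using (filter-⊆)
open import Data.List.Relation.Unary.All as All using (All; []; _∷_)
import Data.List.Relation.Unary.All.Properties as All
open import Data.List.Relation.Unary.AllPairs as AllPairs using (AllPairs; []; _∷_)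
import Data.List.Relation.Unary.AllPairs.Properties as AllPairs
open import Data.List.Relation.Unary.Any as Any using (Any; here; there)
import Data.List.Relation.Unary.Any.Properties as Any
open import Data.List.Relation.Unary.Unique.Propositional using (Unique)
import Data.List.Relation.Unary.Unique.Propositional.Properties as Unique
open import Data.Nat.Base using (ℕ; zero; suc; _+_; _≤_; _<_; _∸_; ⌈_/2⌉; z≤n; s≤s)
open import Data.Nat.Combinatorics
  using (_C_; nCk+nC[k+1]≡[n+1]C[k+1]; nC1≡n; k>n⇒nCk≡0)
open import Data.Nat.ListAction using (sum)
import Data.Nat.Properties as ℕ
open import Data.Product.Base using (_×_; _,_; proj₁; proj₂; ∃; uncurry)
open import Data.Sum.Base using (_⊎_; inj₁; inj₂; swap)
open import Data.Vec.Base using (here; there) renaming (_∷_ to _∷ᵛ_; [] to []ᵛ)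
import Data.Vec.Properties as Vec
open import Function.Base using (_∘_; id)
open import Function.Bundles using (mk⇔; Equivalence)
open import Level using (Level)
open import Relation.Binary.Core using (Rel)
open import Relation.Binary.Definitions using (Decidable; tri<; tri≈; tri>)
open import Relation.Binary.PropositionalEquality
  using (_≡_; _≢_; refl; sym; trans; cong; cong₂; subst; subst₂; ≢-sym; module ≡-Reasoning)
open import Relation.Nullary using (¬_; Dec; yes; no; does; contradiction)
open import Relation.Nullary.Decidable using (_×-dec_; ¬?; dec-true; dec-false)
import Relation.Unary as U

open Equivalence using (to; from)
open Graph using () renaming (_~_ to adj; _~?_ to adj?)

-- Counting is done in ℤ with sums over lists of 0/1 indicators, so that no bijection between sets
-- of objects has to be built: double sums are exchanged, and an inner sum collapses to one
-- indicator as soon as at most one entry can satisfy the predicate. Deduplication selects class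
-- representatives that cannot be written down. Three facts about `classes` have to suffice: its
-- entries have the prescribed numbers of vertices and edges, they are pairwise non-isomorphic, and
-- every edge set with v endpoints and e edges carries a copy of one of them. The last fact requires
-- an actual graph on `Fin v`, obtained by renaming the endpoints of the edge set. The double sum of
-- the first identity starts at v = 2, below which only the empty edge set lies; that set accounts
-- for the separate term C(n, k). The limits for e hold for every edge set, so the double sum loses
-- nothing else.

private
  variable
    a b p q r : Level
    A B : Set a
    m n : ℕ

-- Integer sums over lists and indicators

∑ˡ : List A → (A → ℤ) → ℤ
∑ˡ xs f = foldr _+ᶻ_ 0ℤ (map f xs)

-- The Iverson bracket. It inspects only `does`, so sums of brackets do not depend on the proofs
-- inside the decisions.
⟦_⟧ : {P : Set p} → Dec P → ℤ
⟦ P? ⟧ = if does P? then 1ℤ else 0ℤ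

∑ˡ-cong : {f g : A → ℤ} (xs : List A) → (∀ {x} → x ∈ xs → f x ≡ g x) → ∑ˡ xs f ≡ ∑ˡ xs g
∑ˡ-cong []       f≗g = refl
∑ˡ-cong (x ∷ xs) f≗g = cong₂ _+ᶻ_ (f≗g (here refl)) (∑ˡ-cong xs (f≗g ∘ there))

∑ˡ-map : (g : A → B) (f : B → ℤ) (xs : List A) → ∑ˡ (map g xs) f ≡ ∑ˡ xs (f ∘ g)
∑ˡ-map g f xs = cong (foldr _+ᶻ_ 0ℤ) (sym (List.map-∘ xs))

∑ˡ-++ : (f : A → ℤ) (xs ys : List A) → ∑ˡ (xs ++ ys) f ≡ ∑ˡ xs f +ᶻ ∑ˡ ys f
∑ˡ-++ f []       ys = sym (ℤ.+-identityˡ _)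
∑ˡ-++ f (x ∷ xs) ys = trans (cong (f x +ᶻ_) (∑ˡ-++ f xs ys)) (sym (ℤ.+-assoc (f x) _ _))

∑ˡ-zero : (xs : List A) → ∑ˡ xs (λ _ → 0ℤ) ≡ 0ℤ
∑ˡ-zero []       = refl
∑ˡ-zero (x ∷ xs) = trans (ℤ.+-identityˡ _) (∑ˡ-zero xs)

∑ˡ-+ : (f g : A → ℤ) (xs : List A) → ∑ˡ xs (λ x → f x +ᶻ g x) ≡ ∑ˡ xs f +ᶻ ∑ˡ xs g
∑ˡ-+ f g []       = refl
∑ˡ-+ f g (x ∷ xs) =
  trans (cong (f x +ᶻ g x +ᶻ_) (∑ˡ-+ f g xs)) (interchange (f x) (g x) _ _)
  where
  interchange : ∀ a b c d → a +ᶻ b +ᶻ (c +ᶻ d) ≡ a +ᶻ c +ᶻ (b +ᶻ d)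
  interchange = solve-∀

∑ˡ-*ˡ : (c : ℤ) (f : A → ℤ) (xs : List A) → ∑ˡ xs (λ x → c *ᶻ f x) ≡ c *ᶻ ∑ˡ xs f
∑ˡ-*ˡ c f []       = sym (ℤ.*-zeroʳ c)
∑ˡ-*ˡ c f (x ∷ xs) =
  trans (cong (c *ᶻ f x +ᶻ_) (∑ˡ-*ˡ c f xs)) (sym (ℤ.*-distribˡ-+ c (f x) _))

∑ˡ-*ʳ : (c : ℤ) (f : A → ℤ) (xs : List A) → ∑ˡ xs (λ x → f x *ᶻ c) ≡ ∑ˡ xs f *ᶻ c
∑ˡ-*ʳ c f xs = trans (∑ˡ-cong xs (λ {x} _ → ℤ.*-comm (f x) c))
                     (trans (∑ˡ-*ˡ c f xs) (ℤ.*-comm c _))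

∑ˡ-swap : (f : A → B → ℤ) (xs : List A) (ys : List B) →
          ∑ˡ xs (λ x → ∑ˡ ys (f x)) ≡ ∑ˡ ys (λ y → ∑ˡ xs (λ x → f x y))
∑ˡ-swap f []       ys = sym (∑ˡ-zero ys)
∑ˡ-swap f (x ∷ xs) ys =
  trans (cong (∑ˡ ys (f x) +ᶻ_) (∑ˡ-swap f xs ys)) (sym (∑ˡ-+ (f x) _ ys))

∑ˡ-cartesianProduct : (f : A × B → ℤ) (xs : List A) (ys : List B) →
  ∑ˡ (cartesianProduct xs ys) f ≡ ∑ˡ xs (λ x → ∑ˡ ys (λ y → f (x , y)))
∑ˡ-cartesianProduct f []       ys = refl
∑ˡ-cartesianProduct f (x ∷ xs) ys =
  trans (∑ˡ-++ f (map (x ,_) ys) _)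
        (cong₂ _+ᶻ_ (∑ˡ-map (x ,_) f ys) (∑ˡ-cartesianProduct f xs ys))

⟦⟧-true : {P : Set p} (P? : Dec P) → P → ⟦ P? ⟧ ≡ 1ℤ
⟦⟧-true P? x rewrite dec-true P? x = refl

⟦⟧-false : {P : Set p} (P? : Dec P) → ¬ P → ⟦ P? ⟧ ≡ 0ℤ
⟦⟧-false P? ¬x rewrite dec-false P? ¬x = refl

⟦⟧-cong : {P : Set p} {Q : Set q} (P? : Dec P) (Q? : Dec Q) →
          (P → Q) → (Q → P) → ⟦ P? ⟧ ≡ ⟦ Q? ⟧
⟦⟧-cong (yes x) Q? f g = sym (⟦⟧-true Q? (f x))
⟦⟧-cong (no ¬x) Q? f g = sym (⟦⟧-false Q? (¬x ∘ g))

⟦⟧-× : {P : Set p} {Q : Set q} (P? : Dec P) (Q? : Dec Q) →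
       ⟦ P? ×-dec Q? ⟧ ≡ ⟦ P? ⟧ *ᶻ ⟦ Q? ⟧
⟦⟧-× (yes _) (yes _) = refl
⟦⟧-× (yes _) (no _)  = refl
⟦⟧-× (no _)  Q?      = refl

⟦⟧-*-cong : {P : Set p} (P? : Dec P) {x y : ℤ} → (P → x ≡ y) → ⟦ P? ⟧ *ᶻ x ≡ ⟦ P? ⟧ *ᶻ y
⟦⟧-*-cong (yes px) x≡y = cong (1ℤ *ᶻ_) (x≡y px)
⟦⟧-*-cong (no _)   x≡y = refl

count-∑ˡ : {P : U.Pred A p} (P? : U.Decidable P) (xs : List A) →
           + count P? xs ≡ ∑ˡ xs (λ x → ⟦ P? x ⟧)
count-∑ˡ P? []       = refl
count-∑ˡ P? (x ∷ xs) with does (P? x)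
... | true  = cong (1ℤ +ᶻ_) (count-∑ˡ P? xs)
... | false = trans (count-∑ˡ P? xs) (sym (ℤ.+-identityˡ _))

sum-∑ˡ : (f : A → ℕ) (xs : List A) → + sum (map f xs) ≡ ∑ˡ xs (λ x → + f x)
sum-∑ˡ f []       = refl
sum-∑ˡ f (x ∷ xs) = cong (+ f x +ᶻ_) (sum-∑ˡ f xs)

module _ {P : U.Pred A p} (P? : U.Decidable P) where

  ∑ˡ-none : (xs : List A) → ¬ Any P xs → ∑ˡ xs (λ x → ⟦ P? x ⟧) ≡ 0ℤ
  ∑ˡ-none xs ¬any = trans
    (∑ˡ-cong xs (λ {x} x∈xs → ⟦⟧-false (P? x) (λ px → ¬any (lose x∈xs px))))
    (∑ˡ-zero xs)

  ∑ˡ-one : {xs : List A} → AllPairs (λ x y → ¬ (P x × P y)) xs → Any P xs →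
           ∑ˡ xs (λ x → ⟦ P? x ⟧) ≡ 1ℤ
  ∑ˡ-one {x ∷ xs} (x# ∷ _) (here px) =
    cong₂ _+ᶻ_ (⟦⟧-true (P? x) px)
               (∑ˡ-none xs (λ any → let y , y∈xs , py = find any in
                                    All.lookup x# y∈xs (px , py)))
  ∑ˡ-one {x ∷ xs} (x# ∷ apart) (there any) =
    cong₂ _+ᶻ_ (⟦⟧-false (P? x) (λ px → let y , y∈xs , py = find any in
                                        All.lookup x# y∈xs (px , py)))
               (∑ˡ-one apart any)

  -- Turns existence and uniqueness into an identity of sums. Exclusivity is asked of pairs of
  -- positions instead of deriving equal entries, because for class representatives the conflict
  -- between two entries is an isomorphism, not an equality.
  ∑ˡ-exclusive : {Q : Set q} (Q? : Dec Q) {xs : List A} →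
                 AllPairs (λ x y → ¬ (P x × P y)) xs →
                 (Q → Any P xs) → (Any P xs → Q) →
                 ∑ˡ xs (λ x → ⟦ P? x ⟧) ≡ ⟦ Q? ⟧
  ∑ˡ-exclusive (yes x) apart to from = ∑ˡ-one apart (to x)
  ∑ˡ-exclusive (no ¬x) apart to from = ∑ˡ-none _ (¬x ∘ from)

unique⇒exclusive : {P : U.Pred A p} {xs : List A} →
                   (∀ {x y} → x ∈ xs → y ∈ xs → P x → P y → x ≡ y) →
                   Unique xs → AllPairs (λ x y → ¬ (P x × P y)) xs
unique⇒exclusive inj []          = []
unique⇒exclusive inj (x# ∷ uniq) =
    All.tabulate (λ y∈xs (px , py) →
      All.lookup x# y∈xs (inj (here refl) (there y∈xs) px py))
  ∷ unique⇒exclusive (λ x∈xs y∈xs → inj (there x∈xs) (there y∈xs)) uniq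

module _ (m lo hi : ℕ) (f : ℕ → ℤ) where

  private
    is : List ℕ
    is = upTo (suc hi ∸ lo)

    -- Only an index with `lo + i` equal to `m` survives, so `f (lo + i)` may be replaced by the
    -- constant `f m`; what remains counts how often `m` is hit.
    factor : (∑[ lo ≤ i ≤ hi ] ⟦ m ℕ.≟ i ⟧ *ᶻ f i)
             ≡ ∑ˡ is (λ i → ⟦ m ℕ.≟ lo + i ⟧) *ᶻ f m
    factor = trans
      (∑ˡ-cong is (λ {i} _ → ⟦⟧-*-cong (m ℕ.≟ lo + i) (λ m≡lo+i → cong f (sym m≡lo+i))))
      (∑ˡ-*ʳ (f m) _ is)

  ∑-fibre : lo ≤ m → m ≤ hi → (∑[ lo ≤ i ≤ hi ] ⟦ m ℕ.≟ i ⟧ *ᶻ f i) ≡ f m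
  ∑-fibre lo≤m m≤hi = trans factor (trans (cong (_*ᶻ f m) one) (ℤ.*-identityˡ (f m)))
    where
    one = ∑ˡ-one (λ i → m ℕ.≟ lo + i)
            (unique⇒exclusive
              (λ {i} {j} _ _ m≡lo+i m≡lo+j → ℕ.+-cancelˡ-≡ lo i j (trans (sym m≡lo+i) m≡lo+j))
              (Unique.upTo⁺ (suc hi ∸ lo)))
            (lose (∈-upTo⁺ (ℕ.∸-monoˡ-< (s≤s m≤hi) lo≤m)) (sym (ℕ.m+[n∸m]≡n lo≤m)))

  ∑-fibre-∉ : ¬ (lo ≤ m × m ≤ hi) → (∑[ lo ≤ i ≤ hi ] ⟦ m ℕ.≟ i ⟧ *ᶻ f i) ≡ 0ℤ
  ∑-fibre-∉ m∉ = trans factor (cong (_*ᶻ f m) (∑ˡ-none (λ i → m ℕ.≟ lo + i) is outside))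
    where
    outside : ¬ Any (λ i → m ≡ lo + i) is
    outside any with i , i∈is , refl ← find any =
      m∉ (ℕ.m≤m+n lo i , ℕ.≤-pred (begin
        suc (lo + i)              ≡⟨ ℕ.+-suc lo i ⟨
        lo + suc i                ≤⟨ ℕ.+-monoʳ-≤ lo i<len ⟩
        lo + (suc hi ∸ lo)        ≡⟨ ℕ.m+[n∸m]≡n lo≤1+hi ⟩
        suc hi                    ∎))
      where
      open ℕ.≤-Reasoning
      i<len = ∈-upTo⁻ i∈is
      -- A member of `is` shows that its length `suc hi ∸ lo` is nonzero, so the subtraction was not
      -- truncated.
      lo≤1+hi = ℕ.<⇒≤ (ℕ.m∸n≢0⇒n<m {suc hi} {lo} (ℕ.m<n⇒n≢0 i<len))

∑ˡ-filter : {P : U.Pred A p} (P? : U.Decidable P) (f : A → ℤ) (xs : List A) →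
            ∑ˡ (filter P? xs) f ≡ ∑ˡ xs (λ x → ⟦ P? x ⟧ *ᶻ f x)
∑ˡ-filter P? f []       = refl
∑ˡ-filter P? f (x ∷ xs) with does (P? x)
... | true  = cong₂ _+ᶻ_ (sym (ℤ.*-identityˡ (f x))) (∑ˡ-filter P? f xs)
... | false = trans (∑ˡ-filter P? f xs) (sym (ℤ.+-identityˡ _))

-- Comparing lengths; sublists and subsets as duplicate-free enumerations

length-inj : {R : A → B → Set r} {xs : List A} {ys : List B} → Unique xs →
             (∀ {x} → x ∈ xs → ∃ λ y → y ∈ ys × R x y) →
             (∀ {x x′ y} → R x y → R x′ y → x ≡ x′) →
             length xs ≤ length ys
length-inj {xs = []} _ _ _ = z≤n
length-inj {R = R} {xs = x ∷ xs} (x# ∷ uniq) total inj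
  with y , y∈ys , Rxy ← total (here refl)
  -- The partner `y` of the head is deleted from `ys`. By injectivity no later entry has `y` as its
  -- partner, since the head does not recur in `xs`.
  with as , bs , refl ← ∈-∃++ y∈ys = begin
    suc (length xs)              ≤⟨ s≤s (length-inj uniq total′ inj) ⟩
    suc (length (as ++ bs))      ≡⟨ List.length-++-sucʳ as y bs ⟨
    length (as ++ y ∷ bs)        ∎
  where
  open ℕ.≤-Reasoning
  total′ : ∀ {x′} → x′ ∈ xs → ∃ λ y′ → y′ ∈ as ++ bs × R x′ y′
  total′ x′∈xs with y′ , y′∈ , Rx′y′ ← total (there x′∈xs) with ∈-++⁻ as y′∈
  ... | inj₁ y′∈as         = y′ , ∈-++⁺ˡ y′∈as , Rx′y′
  ... | inj₂ (there y′∈bs) = y′ , ∈-++⁺ʳ as y′∈bs , Rx′y′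
  ... | inj₂ (here refl)   = contradiction (inj Rxy Rx′y′) (All.lookup x# x′∈xs)

length-⊆ : {xs ys : List A} → Unique xs → (∀ {x} → x ∈ xs → x ∈ ys) → length xs ≤ length ys
length-⊆ uniq xs⊆ys = length-inj {R = _≡_} uniq (λ x∈xs → _ , xs⊆ys x∈xs , refl)
                                 (λ x≡y x′≡y → trans x≡y (sym x′≡y))

∈sublists⇒⊑ : {xs E : List A} → E ∈ sublists xs → E ⊑ xs
∈sublists⇒⊑ {xs = []}     (here refl) = []
∈sublists⇒⊑ {xs = x ∷ xs} E∈ with ∈-++⁻ (sublists xs) E∈
... | inj₁ E∈xs = x ∷ʳ ∈sublists⇒⊑ E∈xs
... | inj₂ E∈map with E′ , E′∈xs , refl ← ∈-map⁻ (x ∷_) E∈map = refl ∷ ∈sublists⇒⊑ E′∈xs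

⊑⇒∈sublists : {xs E : List A} → E ⊑ xs → E ∈ sublists xs
⊑⇒∈sublists []         = here refl
⊑⇒∈sublists (x ∷ʳ E⊑)  = ∈-++⁺ˡ (⊑⇒∈sublists E⊑)
⊑⇒∈sublists {xs = x ∷ xs} (refl ∷ E⊑) = ∈-++⁺ʳ (sublists xs) (∈-map⁺ (x ∷_) (⊑⇒∈sublists E⊑))

⊑-Unique : {xs E : List A} → E ⊑ xs → Unique xs → Unique E
⊑-Unique []         _            = []
⊑-Unique (x ∷ʳ E⊑)  (_ ∷ uniq)   = ⊑-Unique E⊑ uniq
⊑-Unique (refl ∷ E⊑) (x# ∷ uniq) =
  All.tabulate (All.lookup x# ∘ ⊑-lookup E⊑) ∷ ⊑-Unique E⊑ uniq

-- The ambient list `xs` fixes both order and multiplicity, so a sublist is determined by its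
-- members. This lets edge sets, which are lists, be compared by propositional equality.
⊑-ext : {xs E E′ : List A} → Unique xs → E ⊑ xs → E′ ⊑ xs →
        (∀ {x} → x ∈ E → x ∈ E′) → (∀ {x} → x ∈ E′ → x ∈ E) → E ≡ E′
⊑-ext _ [] [] _ _ = refl
⊑-ext (_ ∷ uniq) (_ ∷ʳ s) (_ ∷ʳ t) E⊆E′ E′⊆E = ⊑-ext uniq s t E⊆E′ E′⊆E
⊑-ext (x# ∷ _) (refl ∷ _) (_ ∷ʳ t) E⊆E′ _ =
  contradiction refl (All.lookup x# (⊑-lookup t (E⊆E′ (here refl))))
⊑-ext (x# ∷ _) (_ ∷ʳ s) (refl ∷ _) _ E′⊆E =
  contradiction refl (All.lookup x# (⊑-lookup s (E′⊆E (here refl))))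
⊑-ext (x# ∷ uniq) (refl ∷ s) (refl ∷ t) E⊆E′ E′⊆E =
  cong (_ ∷_) (⊑-ext uniq s t (λ z∈E → drop s z∈E (E⊆E′ (there z∈E)))
                              (λ z∈E′ → drop t z∈E′ (E′⊆E (there z∈E′))))
  where
  drop : ∀ {z ys zs} → zs ⊑ _ → z ∈ zs → z ∈ _ ∷ ys → z ∈ ys
  drop u z∈zs (here refl) = contradiction refl (All.lookup x# (⊑-lookup u z∈zs))
  drop u z∈zs (there z∈ys) = z∈ys

sublists-Unique : {xs : List A} → Unique xs → Unique (sublists xs)
sublists-Unique []          = [] ∷ []
sublists-Unique {xs = x ∷ xs} (x# ∷ uniq) = Unique.++⁺ (sublists-Unique uniq)
  (Unique.map⁺ List.∷-injectiveʳ (sublists-Unique uniq))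
  (λ (E∈ , E∈map) → contradiction refl
     (All.lookup x# (⊑-lookup (∈sublists⇒⊑ E∈) (∈-map∷⁻ E∈map))))

subsets-Unique : ∀ n → Unique (subsets n)
subsets-Unique zero    = [] ∷ []
subsets-Unique (suc n) = Unique.++⁺
  (Unique.map⁺ Vec.∷-injectiveʳ (subsets-Unique n))
  (Unique.map⁺ Vec.∷-injectiveʳ (subsets-Unique n))
  disjoint
  where
  disjoint : ∀ {S} → ¬ (S ∈ map (false ∷ᵛ_) (subsets n) × S ∈ map (true ∷ᵛ_) (subsets n))
  disjoint (f∈ , t∈) with _ , _ , refl ← ∈-map⁻ (false ∷ᵛ_) f∈ with ∈-map⁻ (true ∷ᵛ_) t∈
  ... | _ , _ , ()

∈-subsets : (S : Subset n) → S ∈ subsets n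
∈-subsets []ᵛ          = here refl
∈-subsets (false ∷ᵛ S) = ∈-++⁺ˡ (∈-map⁺ (false ∷ᵛ_) (∈-subsets S))
∈-subsets {suc n} (true ∷ᵛ S) =
  ∈-++⁺ʳ (map (false ∷ᵛ_) (subsets n)) (∈-map⁺ (true ∷ᵛ_) (∈-subsets S))

-- Counting the pairs inside a vertex set

∑-allFin-suc : (f : Fin (suc n) → ℤ) →
               ∑ˡ (allFin (suc n)) f ≡ f Fin.zero +ᶻ ∑ˡ (allFin n) (f ∘ Fin.suc)
∑-allFin-suc {n} f = cong (f Fin.zero +ᶻ_)
  (trans (cong (λ xs → ∑ˡ xs f) (sym (List.map-tabulate id Fin.suc))) (∑ˡ-map Fin.suc f (allFin n)))

∑ˡ-∈? : (S : Subset n) → ∑ˡ (allFin n) (λ i → ⟦ i ∈? S ⟧) ≡ + ∣ S ∣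
∑ˡ-∈? []ᵛ          = refl
∑ˡ-∈? (true ∷ᵛ S)  = trans (∑-allFin-suc (λ i → ⟦ i ∈? true ∷ᵛ S ⟧)) (cong (1ℤ +ᶻ_) (∑ˡ-∈? S))
∑ˡ-∈? (false ∷ᵛ S) =
  trans (∑-allFin-suc (λ i → ⟦ i ∈? false ∷ᵛ S ⟧)) (trans (ℤ.+-identityˡ _) (∑ˡ-∈? S))

infix 4 _∈²_ _∈²?_

_∈²_ : Fin n × Fin n → Subset n → Set
(i , j) ∈² S = i ∈ₛ S × j ∈ₛ S

_∈²?_ : (e : Fin n × Fin n) (S : Subset n) → Dec (e ∈² S)
(i , j) ∈²? S = (i ∈? S) ×-dec (j ∈? S)

private
  inside< : Subset n → Fin n → Fin n → ℤ
  inside< S i j = ⟦ i Fin.<? j ⟧ *ᶻ ⟦ (i , j) ∈²? S ⟧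

-- Splitting off vertex zero gives Pascal's rule. Nothing lies below zero, so column zero vanishes;
-- row zero contributes `∣ S ∣`, read as C(|S|, 1), exactly when zero is in the set.
∑-inside< : (S : Subset n) →
            ∑ˡ (allFin n) (λ i → ∑ˡ (allFin n) (inside< S i)) ≡ + (∣ S ∣ C 2)
∑-inside< []ᵛ = refl
∑-inside< {suc n} (s ∷ᵛ S) = begin
  ∑ˡ (allFin (suc n)) (λ i → ∑ˡ (allFin (suc n)) (inside< (s ∷ᵛ S) i))
    ≡⟨ ∑-allFin-suc (λ i → ∑ˡ (allFin (suc n)) (inside< (s ∷ᵛ S) i)) ⟩
  ∑ˡ (allFin (suc n)) (inside< (s ∷ᵛ S) Fin.zero)
    +ᶻ ∑ˡ (allFin n) (λ i → ∑ˡ (allFin (suc n)) (inside< (s ∷ᵛ S) (Fin.suc i)))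
    ≡⟨ cong₂ _+ᶻ_
         (trans (∑-allFin-suc (inside< (s ∷ᵛ S) Fin.zero)) (ℤ.+-identityˡ (fromZero s)))
         (∑ˡ-cong {g = λ i → ∑ˡ (allFin n) (inside< S i)} (allFin n)
           (λ {i} _ → trans (∑-allFin-suc (inside< (s ∷ᵛ S) (Fin.suc i)))
                            (ℤ.+-identityˡ (∑ˡ (allFin n) (inside< S i))))) ⟩
  fromZero s +ᶻ ∑ˡ (allFin n) (λ i → ∑ˡ (allFin n) (inside< S i))
    ≡⟨ cong₂ _+ᶻ_ (from-zero s) (∑-inside< S) ⟩
  + (if s then ∣ S ∣ else 0) +ᶻ + (∣ S ∣ C 2)
    ≡⟨ pascal s ⟩
  + (∣ s ∷ᵛ S ∣ C 2) ∎
  where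
  open ≡-Reasoning
  fromZero : Bool → ℤ
  fromZero s = ∑ˡ (allFin n) (λ j → inside< (s ∷ᵛ S) Fin.zero (Fin.suc j))
  from-zero : ∀ s → fromZero s ≡ + (if s then ∣ S ∣ else 0)
  from-zero true  = trans (∑ˡ-cong (allFin n) (λ {j} _ → ℤ.*-identityˡ ⟦ j ∈? S ⟧)) (∑ˡ-∈? S)
  from-zero false = ∑ˡ-zero (allFin n)
  pascal : ∀ s → + (if s then ∣ S ∣ else 0) +ᶻ + (∣ S ∣ C 2) ≡ + (∣ s ∷ᵛ S ∣ C 2)
  pascal true  = cong +_ (trans (cong (_+ ∣ S ∣ C 2) (sym (nC1≡n ∣ S ∣)))
                                (nCk+nC[k+1]≡[n+1]C[k+1] ∣ S ∣ 1))
  pascal false = refl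

count-pairs-inside : (S : Subset n) → count (_∈²? S) (pairs n) ≡ ∣ S ∣ C 2
count-pairs-inside {n} S = ℤ.+-injective (begin
  + count (_∈²? S) (pairs n)
    ≡⟨ count-∑ˡ (_∈²? S) (pairs n) ⟩
  ∑ˡ (pairs n) (λ e → ⟦ e ∈²? S ⟧)
    ≡⟨ ∑ˡ-filter (uncurry Fin._<?_) _ (cartesianProduct (allFin n) (allFin n)) ⟩
  ∑ˡ (cartesianProduct (allFin n) (allFin n)) (uncurry (inside< S))
    ≡⟨ ∑ˡ-cartesianProduct (uncurry (inside< S)) (allFin n) (allFin n) ⟩
  ∑ˡ (allFin n) (λ i → ∑ˡ (allFin n) (inside< S i))
    ≡⟨ ∑-inside< S ⟩
  + (∣ S ∣ C 2) ∎)
  where open ≡-Reasoning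

-- Counting the k-sets that contain a given set

superset? : (k : ℕ) (T S : Subset n) → Dec (∣ S ∣ ≡ k × T ⊆ₛ S)
superset? k T S = (∣ S ∣ ℕ.≟ k) ×-dec (T ⊆? S)

private
  -- The two halves are the sets without and with the first vertex. If that vertex is outside the
  -- given set, they become the two terms of Pascal's rule.
  ∑-superset-split : (k : ℕ) (t : Bool) (T : Subset n) →
    ∑ˡ (subsets (suc n)) (λ S → ⟦ superset? k (t ∷ᵛ T) S ⟧) ≡
    ∑ˡ (subsets n) (λ S → ⟦ superset? k (t ∷ᵛ T) (false ∷ᵛ S) ⟧) +ᶻ
    ∑ˡ (subsets n) (λ S → ⟦ superset? k (t ∷ᵛ T) (true ∷ᵛ S) ⟧)
  ∑-superset-split {n} k t T = trans (∑ˡ-++ _ (map (false ∷ᵛ_) (subsets n)) _)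
    (cong₂ _+ᶻ_ (∑ˡ-map (false ∷ᵛ_) _ (subsets n)) (∑ˡ-map (true ∷ᵛ_) _ (subsets n)))

-- This case is kept apart because for `k < ∣ T ∣` the expression `(n ∸ ∣ T ∣) C (k ∸ ∣ T ∣)` would
-- be 1 by truncation, while there is no such superset.
∑-superset-> : (k : ℕ) (T : Subset n) → k < ∣ T ∣ →
               ∑ˡ (subsets n) (λ S → ⟦ superset? k T S ⟧) ≡ 0ℤ
∑-superset-> {n} k T k<∣T∣ = ∑ˡ-none (superset? k T) (subsets n) none
  where
  none : ¬ Any _ (subsets n)
  none any with _ , _ , refl , T⊆S ← find any = ℕ.<⇒≱ k<∣T∣ (Subset.p⊆q⇒∣p∣≤∣q∣ T⊆S)

private
  ∑-superset-outside : (k : ℕ) (T : Subset n) →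
    ∑ˡ (subsets n) (λ S → ⟦ superset? k (false ∷ᵛ T) (false ∷ᵛ S) ⟧) ≡
    ∑ˡ (subsets n) (λ S → ⟦ superset? k T S ⟧)
  ∑-superset-outside {n} k T = ∑ˡ-cong (subsets n) (λ {S} _ →
    ⟦⟧-cong (superset? k (false ∷ᵛ T) (false ∷ᵛ S)) (superset? k T S)
      (λ (c , T⊆S) → c , Subset.drop-∷-⊆ T⊆S)
      (λ (c , T⊆S) → c , Subset.out⊆ T⊆S))

  ∑-superset-inside : (k : ℕ) (t : Bool) (T : Subset n) →
    ∑ˡ (subsets n) (λ S → ⟦ superset? (suc k) (t ∷ᵛ T) (true ∷ᵛ S) ⟧) ≡
    ∑ˡ (subsets n) (λ S → ⟦ superset? k T S ⟧)
  ∑-superset-inside {n} k t T = ∑ˡ-cong (subsets n) (λ {S} _ →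
    ⟦⟧-cong (superset? (suc k) (t ∷ᵛ T) (true ∷ᵛ S)) (superset? k T S)
      (λ (c , T⊆S) → ℕ.suc-injective c , Subset.drop-∷-⊆ T⊆S)
      (λ (c , T⊆S) → cong suc c , lift t T⊆S))
    where
    lift : ∀ t {S} → T ⊆ₛ S → (t ∷ᵛ T) ⊆ₛ (true ∷ᵛ S)
    lift true  = Subset.s⊆s
    lift false = Subset.out⊆

-- Writing k = ∣ T ∣ + b avoids the truncated subtraction k ∸ ∣ T ∣.
∑-superset : (T : Subset n) (b : ℕ) →
  ∑ˡ (subsets n) (λ S → ⟦ superset? (∣ T ∣ + b) T S ⟧) ≡ + ((n ∸ ∣ T ∣) C b)
∑-superset []ᵛ zero    = refl
∑-superset []ᵛ (suc b) = cong +_ (sym (k>n⇒nCk≡0 {0} {suc b} (s≤s z≤n)))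
∑-superset {suc n} (true ∷ᵛ T) b = trans (∑-superset-split _ true T) (trans (cong₂ _+ᶻ_
  (∑ˡ-none (superset? (suc ∣ T ∣ + b) (true ∷ᵛ T) ∘ (false ∷ᵛ_)) (subsets n) none)
  (trans (∑-superset-inside (∣ T ∣ + b) true T) (∑-superset T b)))
  (ℤ.+-identityˡ _))
  where
  none : ¬ Any _ (subsets n)
  none any with _ , _ , _ , T⊆S ← find any with () ← T⊆S here
∑-superset {suc n} (false ∷ᵛ T) zero = trans (∑-superset-split _ false T) (cong₂ _+ᶻ_
  (trans (∑-superset-outside (∣ T ∣ + 0) T) (∑-superset T 0))
  (∑ˡ-none (superset? (∣ T ∣ + 0) (false ∷ᵛ T) ∘ (true ∷ᵛ_)) (subsets n) none))
  where
  none : ¬ Any _ (subsets n)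
  none any with _ , _ , eq , T⊆S ← find any =
    ℕ.<⇒≱ (ℕ.≤-reflexive (trans eq (ℕ.+-identityʳ ∣ T ∣)))
          (Subset.p⊆q⇒∣p∣≤∣q∣ (Subset.drop-∷-⊆ T⊆S))
∑-superset {suc n} (false ∷ᵛ T) (suc b) = begin
  ∑ˡ (subsets (suc n)) (λ S → ⟦ superset? (∣ T ∣ + suc b) (false ∷ᵛ T) S ⟧)
    ≡⟨ ∑-superset-split (∣ T ∣ + suc b) false T ⟩
  _ ≡⟨ cong₂ _+ᶻ_
         (trans (∑-superset-outside (∣ T ∣ + suc b) T) (∑-superset T (suc b)))
         (trans (cong (λ k → ∑ˡ (subsets n) (λ S → ⟦ superset? k (false ∷ᵛ T) (true ∷ᵛ S) ⟧))
                      (ℕ.+-suc ∣ T ∣ b))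
                (trans (∑-superset-inside (∣ T ∣ + b) false T) (∑-superset T b))) ⟩
  + ((n ∸ ∣ T ∣) C suc b + (n ∸ ∣ T ∣) C b)
    ≡⟨ cong +_ (ℕ.+-comm ((n ∸ ∣ T ∣) C suc b) _) ⟩
  + ((n ∸ ∣ T ∣) C b + (n ∸ ∣ T ∣) C suc b)
    ≡⟨ cong +_ (nCk+nC[k+1]≡[n+1]C[k+1] (n ∸ ∣ T ∣) b) ⟩
  + (suc (n ∸ ∣ T ∣) C suc b)
    ≡⟨ cong (λ m → + (m C suc b)) (ℕ.+-∸-assoc 1 (Subset.∣p∣≤n T)) ⟨
  + ((suc n ∸ ∣ T ∣) C suc b) ∎
  where open ≡-Reasoning

-- Edge lists and their endpoints

∈-pairs⁺ : {i j : Fin n} → i Fin.< j → (i , j) ∈ pairs n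
∈-pairs⁺ i<j = ∈-filter⁺ (uncurry Fin._<?_) (∈-cartesianProduct⁺ (∈-allFin _) (∈-allFin _)) i<j

∈-pairs⁻ : {i j : Fin n} → (i , j) ∈ pairs n → i Fin.< j
∈-pairs⁻ {n} = proj₂ ∘ ∈-filter⁻ (uncurry Fin._<?_) {xs = cartesianProduct (allFin n) (allFin n)}

pairs-Unique : ∀ n → Unique (pairs n)
pairs-Unique n = Unique.filter⁺ _ (Unique.cartesianProduct⁺ (Unique.allFin⁺ n) (Unique.allFin⁺ n))

module _ (G : Graph n) where

  edges-⊑ : edges G ⊑ pairs n
  edges-⊑ = filter-⊆ (uncurry (adj? G)) (pairs n)

  edges-Unique : Unique (edges G)
  edges-Unique = ⊑-Unique edges-⊑ (pairs-Unique n)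

  ∈-edges⁺ : ∀ {i j} → i Fin.< j → adj G i j → (i , j) ∈ edges G
  ∈-edges⁺ i<j = ∈-filter⁺ (uncurry (adj? G)) (∈-pairs⁺ i<j)

  ∈-edges⁻ : ∀ {i j} → (i , j) ∈ edges G → i Fin.< j × adj G i j
  ∈-edges⁻ ij∈ with ij∈pairs , i~j ← ∈-filter⁻ (uncurry (adj? G)) {xs = pairs n} ij∈ =
    ∈-pairs⁻ ij∈pairs , i~j

vertices : List (Fin n × Fin n) → Subset n
vertices []            = ⊥
vertices ((i , j) ∷ E) = (⁅ i ⁆ ∪ ⁅ j ⁆) ∪ vertices E

All-vertices : (E : List (Fin n × Fin n)) {S : Subset n} → vertices E ⊆ₛ S → All (_∈² S) E
All-vertices []            _   = []
All-vertices ((i , j) ∷ E) V⊆S =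
    ( V⊆S (Subset.x∈p∪q⁺ (inj₁ (Subset.x∈p∪q⁺ (inj₁ (Subset.x∈⁅x⁆ i)))))
    , V⊆S (Subset.x∈p∪q⁺ (inj₁ (Subset.x∈p∪q⁺ (inj₂ (Subset.x∈⁅x⁆ j))))))
  ∷ All-vertices E (V⊆S ∘ Subset.x∈p∪q⁺ ∘ inj₂)

∈-vertices⁻ : (E : List (Fin n × Fin n)) {x : Fin n} → x ∈ₛ vertices E →
              ∃ λ y → (x , y) ∈ E ⊎ (y , x) ∈ E
∈-vertices⁻ []            x∈⊥ = contradiction x∈⊥ Subset.∉⊥
∈-vertices⁻ ((i , j) ∷ E) x∈V with Subset.x∈p∪q⁻ (⁅ i ⁆ ∪ ⁅ j ⁆) (vertices E) x∈V
... | inj₂ x∈ with ∈-vertices⁻ E x∈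
...   | y , inj₁ xy∈E = y , inj₁ (there xy∈E)
...   | y , inj₂ yx∈E = y , inj₂ (there yx∈E)
∈-vertices⁻ ((i , j) ∷ E) x∈V | inj₁ x∈ with Subset.x∈p∪q⁻ ⁅ i ⁆ ⁅ j ⁆ x∈
... | inj₁ x∈i with refl ← Subset.x∈⁅y⁆⇒x≡y i x∈i = j , inj₁ (here refl)
... | inj₂ x∈j with refl ← Subset.x∈⁅y⁆⇒x≡y j x∈j = i , inj₂ (here refl)

∈-vertices⁺ : {E : List (Fin n × Fin n)} {x y : Fin n} → (x , y) ∈ E ⊎ (y , x) ∈ E →
              x ∈ₛ vertices E
∈-vertices⁺ {E = E} (inj₁ xy∈E) = proj₁ (All.lookup (All-vertices E id) xy∈E)
∈-vertices⁺ {E = E} (inj₂ yx∈E) = proj₂ (All.lookup (All-vertices E id) yx∈E)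

-- Together with `All-vertices` this makes `vertices E` the least set that E lies inside, so "E is
-- inside S" can be traded for "S is a superset of `vertices E`".
vertices-⊆ : (E : List (Fin n × Fin n)) {S : Subset n} → All (_∈² S) E → vertices E ⊆ₛ S
vertices-⊆ E inside x∈V with ∈-vertices⁻ E x∈V
... | _ , inj₁ xy∈E = proj₁ (All.lookup inside xy∈E)
... | _ , inj₂ yx∈E = proj₂ (All.lookup inside yx∈E)

∣p∪q∣≤∣p∣+∣q∣ : (P Q : Subset n) → ∣ P ∪ Q ∣ ≤ ∣ P ∣ + ∣ Q ∣
∣p∪q∣≤∣p∣+∣q∣ []ᵛ          []ᵛ          = z≤n
∣p∪q∣≤∣p∣+∣q∣ (true ∷ᵛ P)  (true ∷ᵛ Q)  =
  s≤s (ℕ.≤-trans (∣p∪q∣≤∣p∣+∣q∣ P Q) (ℕ.+-monoʳ-≤ ∣ P ∣ (ℕ.n≤1+n _)))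
∣p∪q∣≤∣p∣+∣q∣ (true ∷ᵛ P)  (false ∷ᵛ Q) = s≤s (∣p∪q∣≤∣p∣+∣q∣ P Q)
∣p∪q∣≤∣p∣+∣q∣ (false ∷ᵛ P) (true ∷ᵛ Q)  =
  ℕ.≤-trans (s≤s (∣p∪q∣≤∣p∣+∣q∣ P Q)) (ℕ.≤-reflexive (sym (ℕ.+-suc ∣ P ∣ ∣ Q ∣)))
∣p∪q∣≤∣p∣+∣q∣ (false ∷ᵛ P) (false ∷ᵛ Q) = ∣p∪q∣≤∣p∣+∣q∣ P Q

∣vertices∣≤ : (E : List (Fin n × Fin n)) → ∣ vertices E ∣ ≤ length E + length E
∣vertices∣≤ {n} []       = ℕ.≤-reflexive (Subset.∣⊥∣≡0 n)
∣vertices∣≤ ((i , j) ∷ E) = begin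
  ∣ (⁅ i ⁆ ∪ ⁅ j ⁆) ∪ vertices E ∣          ≤⟨ ∣p∪q∣≤∣p∣+∣q∣ (⁅ i ⁆ ∪ ⁅ j ⁆) (vertices E) ⟩
  ∣ ⁅ i ⁆ ∪ ⁅ j ⁆ ∣ + ∣ vertices E ∣
    ≤⟨ ℕ.+-mono-≤ (∣p∪q∣≤∣p∣+∣q∣ ⁅ i ⁆ ⁅ j ⁆) (∣vertices∣≤ E) ⟩
  ∣ ⁅ i ⁆ ∣ + ∣ ⁅ j ⁆ ∣ + (length E + length E)
    ≡⟨ cong₂ (λ a b → a + b + (length E + length E)) (Subset.∣⁅x⁆∣≡1 i) (Subset.∣⁅x⁆∣≡1 j) ⟩
  suc (suc (length E + length E))           ≡⟨ cong suc (ℕ.+-suc (length E) (length E)) ⟨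
  suc (length E) + suc (length E)           ∎
  where open ℕ.≤-Reasoning

-- Each edge adds at most two endpoints. This is the lower limit for e in the first identity.
⌈∣vertices∣/2⌉≤ : (E : List (Fin n × Fin n)) → ⌈ ∣ vertices E ∣ /2⌉ ≤ length E
⌈∣vertices∣/2⌉≤ E = ℕ.≤-trans (ℕ.⌈n/2⌉-mono (∣vertices∣≤ E))
                              (ℕ.≤-reflexive (sym (ℕ.n≡⌈n+n/2⌉ (length E))))

module _ {E : List (Fin n × Fin n)} (E⊑ : E ⊑ pairs n) where

  -- The edges are distinct pairs inside their own endpoint set. This is the upper limit for e.
  length≤∣vertices∣C2 : length E ≤ ∣ vertices E ∣ C 2
  length≤∣vertices∣C2 = ℕ.≤-trans
    (length-⊆ (⊑-Unique E⊑ (pairs-Unique n))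
      (λ e∈E → ∈-filter⁺ (_∈²? vertices E) (⊑-lookup E⊑ e∈E)
                         (All.lookup (All-vertices E id) e∈E)))
    (ℕ.≤-reflexive (count-pairs-inside (vertices E)))

  -- With fewer than two endpoints the bound C(v, 2) leaves no room for an edge.
  2≤∣vertices∣ : E ≢ [] → 2 ≤ ∣ vertices E ∣
  2≤∣vertices∣ E≢[] with ∣ vertices E ∣ ℕ.<? 2
  ... | no ≮2 = ℕ.≮⇒≥ ≮2
  ... | yes <2 = contradiction (length≡0 E (ℕ.n≤0⇒n≡0 (ℕ.≤-trans length≤∣vertices∣C2
                   (ℕ.≤-reflexive (k>n⇒nCk≡0 <2))))) E≢[]
    where
    length≡0 : (xs : List (Fin n × Fin n)) → length xs ≡ 0 → xs ≡ []
    length≡0 [] _ = refl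

-- Enumerated vertex sets, isomorphisms and copies

enum : (S : Subset n) → Fin ∣ S ∣ → Fin n
enum (true ∷ᵛ S)  Fin.zero    = Fin.zero
enum (true ∷ᵛ S)  (Fin.suc i) = Fin.suc (enum S i)
enum (false ∷ᵛ S) i           = Fin.suc (enum S i)

enum-∈ : (S : Subset n) (i : Fin ∣ S ∣) → enum S i ∈ₛ S
enum-∈ (true ∷ᵛ S)  Fin.zero    = here
enum-∈ (true ∷ᵛ S)  (Fin.suc i) = there (enum-∈ S i)
enum-∈ (false ∷ᵛ S) i           = there (enum-∈ S i)

enum-surjective : (S : Subset n) (x : Fin n) → x ∈ₛ S → ∃ λ i → enum S i ≡ x
enum-surjective (true ∷ᵛ S)  Fin.zero    here        = Fin.zero , refl
enum-surjective (true ∷ᵛ S)  (Fin.suc x) (there x∈S) with i , refl ← enum-surjective S x x∈S =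
  Fin.suc i , refl
enum-surjective (false ∷ᵛ S) (Fin.suc x) (there x∈S) with i , refl ← enum-surjective S x x∈S =
  i , refl

enum-injective : (S : Subset n) (i j : Fin ∣ S ∣) → enum S i ≡ enum S j → i ≡ j
enum-injective (true ∷ᵛ S)  Fin.zero    Fin.zero    _  = refl
enum-injective (true ∷ᵛ S)  (Fin.suc i) (Fin.suc j) eq =
  cong Fin.suc (enum-injective S i j (Fin.suc-injective eq))
enum-injective (false ∷ᵛ S) i           j           eq =
  enum-injective S i j (Fin.suc-injective eq)

≅-trans : {l m n : ℕ} (A : Graph l) (B : Graph m) (H : Graph n) {W : Subset n} →
          A ≅[ Subset.⊤ ] B → B ≅[ W ] H → A ≅[ W ] H
≅-trans _ _ _ (f , _ , f-onto , f-inj , f-pres) (g , g-into , g-onto , g-inj , g-pres) =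
    g ∘ f
  , (λ i → g-into (f i))
  , (λ x x∈W → let j , gj≡x = g-onto x x∈W
                   i , fi≡j = f-onto j Subset.∈⊤
               in i , trans (cong g fi≡j) gj≡x)
  , (λ i j eq → f-inj i j (g-inj (f i) (f j) eq))
  , (λ i j → mk⇔ (to (g-pres _ _) ∘ to (f-pres i j)) (from (f-pres i j) ∘ from (g-pres _ _)))

-- The isomorphism is `f` followed by the inverse of `g`, which is read off from the surjectivity of
-- `g` onto `W`.
≅-join : (A B : Graph m) (H : Graph n) {W : Subset n} → A ≅[ W ] H → B ≅[ W ] H → A ≅ B
≅-join {m = m} _ _ H (f , f-into , f-onto , f-inj , f-pres) (g , g-into , g-onto , g-inj , g-pres) =
    h
  , (λ _ → Subset.∈⊤)
  , (λ j _ → let i , fi≡gj = f-onto (g j) (g-into j)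
             in i , g-inj (h i) j (trans (gh i) fi≡gj))
  , (λ i j hi≡hj → f-inj i j (trans (sym (gh i)) (trans (cong g hi≡hj) (gh j))))
  , (λ i j → mk⇔
      (λ i~j → from (g-pres _ _) (subst₂ (adj H) (sym (gh i)) (sym (gh j)) (to (f-pres i j) i~j)))
      (λ hi~hj → from (f-pres i j) (subst₂ (adj H) (gh i) (gh j) (to (g-pres _ _) hi~hj))))
  where
  h : Fin m → Fin m
  h i = proj₁ (g-onto (f i) (f-into i))
  gh : ∀ i → g (h i) ≡ f i
  gh i = proj₂ (g-onto (f i) (f-into i))

module _ (A : Graph m) where

  private
    nonisolated? : (i : Fin m) → Dec (∃ (adj A i))
    nonisolated? i = Fin.any? (adj? A i)

    length-allFin : length (allFin m) ≡ m
    length-allFin = List.length-tabulate {n = m} id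

  -- `cv A` is the length of a filtered list of all m vertices; if it equals m, the filter has
  -- dropped none.
  cv≡⇒nonisolated : cv A ≡ m → ∀ i → ∃ (adj A i)
  cv≡⇒nonisolated cv≡m i = All.lookup all (∈-allFin i)
    where
    all : All (λ i → ∃ (adj A i)) (allFin m)
    all = subst (All _)
      (List.filter-complete nonisolated? {allFin m} (trans cv≡m (sym length-allFin)))
      (All.all-filter nonisolated? (allFin m))

  nonisolated⇒cv≡ : (∀ i → ∃ (adj A i)) → cv A ≡ m
  nonisolated⇒cv≡ f = trans
    (cong length (List.filter-all nonisolated? {allFin m} (All.tabulate (λ {i} _ → f i))))
    length-allFin

module Iso {A : Graph m} {W : Subset n} {E : List (Fin n × Fin n)}
           (E⊑ : E ⊑ pairs n) (inside : All (_∈² W) E) (A≅E : A ≅[ W ] fromEdges E) where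

  private
    f : Fin m → Fin n
    f = proj₁ A≅E

    f-into = proj₁ (proj₂ A≅E)
    f-onto = proj₁ (proj₂ (proj₂ A≅E))
    f-inj  = proj₁ (proj₂ (proj₂ (proj₂ A≅E)))
    f-pres = proj₂ (proj₂ (proj₂ (proj₂ A≅E)))

  -- There are injections both ways: preimages under `f` of the enumerated points of `W`, and
  -- positions of the values `f i` in the enumeration.
  ∣W∣≡m : ∣ W ∣ ≡ m
  ∣W∣≡m = ℕ.≤-antisym
    (Fin.injective⇒≤ {f = λ i → proj₁ (f-onto (enum W i) (enum-∈ W i))} (λ {i} {j} eq →
      enum-injective W i j (trans (sym (proj₂ (f-onto _ _)))
        (trans (cong f eq) (proj₂ (f-onto _ _))))))
    (Fin.injective⇒≤ {f = λ i → proj₁ (enum-surjective W (f i) (f-into i))} (λ {i} {j} eq →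
      f-inj i j (trans (sym (proj₂ (enum-surjective W _ _)))
                       (trans (cong (enum W) eq) (proj₂ (enum-surjective W _ _))))))

  private
    -- Edges are stored as increasing pairs, but `f` need not be monotone. The correspondence of
    -- edges is therefore a relation that admits both orientations of the image.
    R : Fin m × Fin m → Fin n × Fin n → Set
    R (i , j) (x , y) = i Fin.< j × x Fin.< y × ((f i ≡ x × f j ≡ y) ⊎ (f i ≡ y × f j ≡ x))

    R-injective : ∀ {p p′ q} → R p q → R p′ q → p ≡ p′
    R-injective (_ , _ , inj₁ (refl , refl)) (_ , _ , inj₁ (eq , eq′)) =
      cong₂ _,_ (sym (f-inj _ _ eq)) (sym (f-inj _ _ eq′))
    R-injective (_ , _ , inj₂ (refl , refl)) (_ , _ , inj₂ (eq , eq′)) =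
      cong₂ _,_ (sym (f-inj _ _ eq)) (sym (f-inj _ _ eq′))
    -- Reaching the same pair in opposite orientations would give both `i < j` and `j < i`.
    R-injective (i<j , _ , inj₁ (refl , refl)) (i′<j′ , _ , inj₂ (eq , eq′))
      with refl ← f-inj _ _ eq | refl ← f-inj _ _ eq′ = contradiction i′<j′ (ℕ.<-asym i<j)
    R-injective (i<j , _ , inj₂ (refl , refl)) (i′<j′ , _ , inj₁ (eq , eq′))
      with refl ← f-inj _ _ eq | refl ← f-inj _ _ eq′ = contradiction i′<j′ (ℕ.<-asym i<j)

    R-functional : ∀ {p q q′} → R p q → R p q′ → q ≡ q′
    R-functional (_ , _ , inj₁ (refl , refl)) (_ , _ , inj₁ (refl , refl)) = refl
    R-functional (_ , _ , inj₂ (refl , refl)) (_ , _ , inj₂ (refl , refl)) = refl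
    R-functional (_ , x<y , inj₁ (refl , refl)) (_ , x′<y′ , inj₂ (refl , refl)) =
      contradiction x′<y′ (ℕ.<-asym x<y)
    R-functional (_ , x<y , inj₂ (refl , refl)) (_ , x′<y′ , inj₁ (refl , refl)) =
      contradiction x′<y′ (ℕ.<-asym x<y)

    R-total : ∀ {p} → p ∈ edges A → ∃ λ q → q ∈ E × R p q
    R-total {i , j} p∈ with i<j , i~j ← ∈-edges⁻ A p∈ with to (f-pres i j) i~j
    ... | _ , inj₁ q∈ = _ , q∈ , i<j , ∈-pairs⁻ (⊑-lookup E⊑ q∈) , inj₁ (refl , refl)
    ... | _ , inj₂ q∈ = _ , q∈ , i<j , ∈-pairs⁻ (⊑-lookup E⊑ q∈) , inj₂ (refl , refl)

    R-surjective : ∀ {q} → q ∈ E → ∃ λ p → p ∈ edges A × R p q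
    R-surjective {x , y} q∈ with x∈W , y∈W ← All.lookup inside q∈
      with x<y ← ∈-pairs⁻ (⊑-lookup E⊑ q∈)
      with i , refl ← f-onto x x∈W | j , refl ← f-onto y y∈W
      with i~j ← from (f-pres i j) (Fin.<⇒≢ x<y , inj₁ q∈)
      with Fin.<-cmp i j
    ... | tri< i<j _ _ = (i , j) , ∈-edges⁺ A i<j i~j , i<j , x<y , inj₁ (refl , refl)
    ... | tri≈ _ i≡j _ = contradiction i~j (Graph.irreflexive A i≡j)
    ... | tri> _ _ j<i =
      (j , i) , ∈-edges⁺ A j<i (Graph.symmetric A i~j) , j<i , x<y , inj₂ (refl , refl)

  ∣A∣≡∣E∣ : ∣ A ∣ᴱ ≡ length E
  ∣A∣≡∣E∣ = ℕ.≤-antisym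
    (length-inj {R = R} (edges-Unique A) R-total R-injective)
    (length-inj {R = λ q p → R p q} (⊑-Unique E⊑ (pairs-Unique n)) R-surjective R-functional)

  -- Each vertex of A has a neighbour, and `f` carries the edge between them to an edge of E at the
  -- image of that vertex.
  W≡vertices : cv A ≡ m → W ≡ vertices E
  W≡vertices cv≡m = Subset.⊆-antisym W⊆V (vertices-⊆ E inside)
    where
    W⊆V : W ⊆ₛ vertices E
    W⊆V x∈W with i , refl ← f-onto _ x∈W with j , i~j ← cv≡⇒nonisolated A cv≡m i =
      ∈-vertices⁺ (proj₂ (to (f-pres i j) i~j))

-- Pulls the graph (vertices E , E) back along the enumeration of its vertices.
module Pullback {E : List (Fin n × Fin n)} (E⊑ : E ⊑ pairs n) where

  private
    v : ℕ
    v = ∣ vertices E ∣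

    f : Fin v → Fin n
    f = enum (vertices E)

    H : Graph n
    H = fromEdges E

    preimage? : (p : Fin v × Fin v) → Dec (adj H (f (proj₁ p)) (f (proj₂ p)))
    preimage? (i , j) = adj? H (f i) (f j)

    E₀ : List (Fin v × Fin v)
    E₀ = filter preimage? (pairs v)

  pullback : Graph v
  pullback = fromEdges E₀

  pullback∈graphs : pullback ∈ graphs v
  pullback∈graphs = ∈-map⁺ fromEdges (⊑⇒∈sublists (filter-⊆ preimage? (pairs v)))

  pullback≅E : pullback ≅[ vertices E ] H
  pullback≅E = f , enum-∈ (vertices E) , enum-surjective (vertices E) , enum-injective (vertices E)
      , λ i j → mk⇔ (forth i j) (back i j)
    where
    forth : ∀ i j → adj pullback i j → adj H (f i) (f j)
    forth i j (_ , inj₁ ij∈) = proj₂ (∈-filter⁻ preimage? {xs = pairs v} ij∈)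
    forth i j (_ , inj₂ ji∈) =
      Graph.symmetric H (proj₂ (∈-filter⁻ preimage? {xs = pairs v} ji∈))
    back : ∀ i j → adj H (f i) (f j) → adj pullback i j
    back i j fi~fj with Fin.<-cmp i j
    ... | tri< i<j i≢j _ = i≢j , inj₁ (∈-filter⁺ preimage? (∈-pairs⁺ i<j) fi~fj)
    ... | tri≈ _ refl _  = contradiction fi~fj (Graph.irreflexive H refl)
    ... | tri> _ i≢j j<i =
      i≢j , inj₂ (∈-filter⁺ preimage? (∈-pairs⁺ j<i) (Graph.symmetric H fi~fj))

  -- Each enumerated vertex is an endpoint of some edge in E, whose other endpoint is enumerated
  -- too.
  cv≡v : cv pullback ≡ v
  cv≡v = nonisolated⇒cv≡ pullback neighbour
    where
    neighbour : ∀ i → ∃ λ j → adj pullback i j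
    neighbour i with y , xy∈ ← ∈-vertices⁻ E (enum-∈ (vertices E) i)
      with j , refl ← enum-surjective (vertices E) y (∈-vertices⁺ (swap xy∈)) =
        j , from (proj₂ (proj₂ (proj₂ (proj₂ pullback≅E))) i j) (ne xy∈ , xy∈)
      where
      ne : ∀ {x y} → (x , y) ∈ E ⊎ (y , x) ∈ E → x ≢ y
      ne (inj₁ xy∈) = Fin.<⇒≢ (∈-pairs⁻ (⊑-lookup E⊑ xy∈))
      ne (inj₂ yx∈) = ≢-sym (Fin.<⇒≢ (∈-pairs⁻ (⊑-lookup E⊑ yx∈)))

-- Expressing σ through edge sets

AllPairs-deduplicate : {R : Rel A p} (R? : Decidable R) (xs : List A) →
                       AllPairs (λ x y → ¬ R x y) (deduplicate R? xs)
AllPairs-deduplicate R? []       = []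
AllPairs-deduplicate R? (x ∷ xs) =
    All.all-filter (¬? ∘ R? x) (deduplicate R? xs)
  ∷ AllPairs.filter⁺ (¬? ∘ R? x) (AllPairs-deduplicate R? xs)

classes⁻ : ∀ {v e} {A : Graph v} → A ∈ classes v e → cv A ≡ v × ∣ A ∣ᴱ ≡ e
classes⁻ {v} {e} A∈ =
  proj₂ (∈-filter⁻ (λ A → (cv A ℕ.≟ v) ×-dec (∣ A ∣ᴱ ℕ.≟ e)) {xs = graphs v}
    (∈-deduplicate⁻ _≅?_ _ A∈))

-- The pullback passes the filter, but deduplication may keep another member of its class; the copy
-- is transported to that representative along the isomorphism.
classes-copy : {E : List (Fin n × Fin n)} → E ⊑ pairs n → ∀ {v e} →
               ∣ vertices E ∣ ≡ v → length E ≡ e →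
               Any (λ A → IsCopy A (vertices E , E)) (classes v e)
classes-copy {E = E} E⊑ refl refl = Any.deduplicate⁺ _≅?_
  (λ {A} {B} B≅A (inside , A≅E) → inside , ≅-trans B A (fromEdges E) B≅A A≅E)
  (lose (∈-filter⁺ _ pullback∈graphs (cv≡v , Iso.∣A∣≡∣E∣ {A = pullback} E⊑ inside pullback≅E))
        (inside , pullback≅E))
  where
  open Pullback E⊑
  inside = All-vertices E id

_≟ˢ_ : (S T : Subset n) → Dec (S ≡ T)
_≟ˢ_ = Vec.≡-dec Bool._≟_

∑-subsets-≟ : (T : Subset n) {Q : Set q} (Q? : Dec Q) →
              ∑ˡ (subsets n) (λ S → ⟦ (S ≟ˢ T) ×-dec Q? ⟧) ≡ ⟦ Q? ⟧
∑-subsets-≟ {n} T Q? = ∑ˡ-exclusive (λ S → (S ≟ˢ T) ×-dec Q?) Q?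
  (unique⇒exclusive (λ _ _ (S≡T , _) (S′≡T , _) → trans S≡T (sym S′≡T)) (subsets-Unique n))
  (λ q → lose (∈-subsets T) (refl , q))
  (λ any → proj₂ (proj₂ (proj₂ (find any))))

-- A copy determines its vertex set and its isomorphism class.
∑-copies : {E : List (Fin n × Fin n)} → E ⊑ pairs n → (v e : ℕ) →
  ∑ˡ (subsets n) (λ W → ∑ˡ (classes v e) (λ A → ⟦ isCopy? A (W , E) ⟧))
  ≡ ⟦ (∣ vertices E ∣ ℕ.≟ v) ×-dec (length E ℕ.≟ e) ⟧
∑-copies {n} {E} E⊑ v e =
  trans (∑ˡ-cong (subsets n) (λ {W} _ → one-class W)) (∑-subsets-≟ (vertices E) c?)
  where
  c? : Dec (∣ vertices E ∣ ≡ v × length E ≡ e)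
  c? = (∣ vertices E ∣ ℕ.≟ v) ×-dec (length E ℕ.≟ e)
  W? : (W : Subset n) → Dec (W ≡ vertices E × ∣ vertices E ∣ ≡ v × length E ≡ e)
  W? W = (W ≟ˢ vertices E) ×-dec c?

  one-class : ∀ W → ∑ˡ (classes v e) (λ A → ⟦ isCopy? A (W , E) ⟧) ≡ ⟦ W? W ⟧
  one-class W = ∑ˡ-exclusive (λ A → isCopy? A (W , E)) (W? W)
    (AllPairs.map (λ {A} {B} A≇B ((_ , A≅E) , (_ , B≅E)) → A≇B (≅-join A B (fromEdges E) A≅E B≅E))
                  (AllPairs-deduplicate _≅?_ _))
    (λ { (refl , ∣V∣≡v , ∣E∣≡e) → classes-copy E⊑ ∣V∣≡v ∣E∣≡e })
    determined
    where
    determined : Any (λ A → IsCopy A (W , E)) (classes v e) →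
                 W ≡ vertices E × ∣ vertices E ∣ ≡ v × length E ≡ e
    determined any with A , A∈ , inside , A≅E ← find any with cv≡v , ∣A∣≡e ← classes⁻ A∈ =
      W≡V , trans (cong ∣_∣ (sym W≡V)) ∣W∣≡m , trans (sym ∣A∣≡∣E∣) ∣A∣≡e
      where
      open Iso {A = A} E⊑ inside A≅E
      W≡V = W≡vertices cv≡v

σ-∑ˡ : (G : Graph n) (v e : ℕ) →
       + σ v e G ≡ ∑ˡ (sublists (edges G)) (λ E → ⟦ (∣ vertices E ∣ ℕ.≟ v) ×-dec (length E ℕ.≟ e) ⟧)
σ-∑ˡ {n} G v e = begin
  + σ v e G
    ≡⟨ sum-∑ˡ (λ A → I A G) As ⟩
  ∑ˡ As (λ A → + I A G)
    ≡⟨ ∑ˡ-cong As (λ {A} _ → trans (count-∑ˡ (isCopy? A) (cartesianProduct Ws Es))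
                                   (∑ˡ-cartesianProduct _ Ws Es)) ⟩
  ∑ˡ As (λ A → ∑ˡ Ws (λ W → ∑ˡ Es (λ E → ⟦ isCopy? A (W , E) ⟧)))
    ≡⟨ ∑ˡ-swap _ As Ws ⟩
  ∑ˡ Ws (λ W → ∑ˡ As (λ A → ∑ˡ Es (λ E → ⟦ isCopy? A (W , E) ⟧)))
    ≡⟨ ∑ˡ-cong Ws (λ {W} _ → ∑ˡ-swap _ As Es) ⟩
  ∑ˡ Ws (λ W → ∑ˡ Es (λ E → ∑ˡ As (λ A → ⟦ isCopy? A (W , E) ⟧)))
    ≡⟨ ∑ˡ-swap _ Ws Es ⟩
  ∑ˡ Es (λ E → ∑ˡ Ws (λ W → ∑ˡ As (λ A → ⟦ isCopy? A (W , E) ⟧)))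
    ≡⟨ ∑ˡ-cong Es (λ E∈ → ∑-copies (⊑-trans (∈sublists⇒⊑ E∈) (edges-⊑ G)) v e) ⟩
  ∑ˡ Es (λ E → ⟦ (∣ vertices E ∣ ℕ.≟ v) ×-dec (length E ℕ.≟ e) ⟧) ∎
  where
  open ≡-Reasoning
  As = classes v e
  Ws = subsets n
  Es = sublists (edges G)

-- Alternating sums and independent sets

sgn : List A → ℤ
sgn E = -1ℤ ^ᶻ length E

module _ {P : U.Pred A p} (P? : U.Decidable P) where

  private
    signed : List A → ℤ
    signed xs = ∑ˡ (sublists xs) (λ E → ⟦ All.all? P? E ⟧ *ᶻ sgn E)

    signed-∷ : ∀ x xs → signed (x ∷ xs) ≡ signed xs +ᶻ ⟦ P? x ⟧ *ᶻ (-1ℤ *ᶻ signed xs)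
    signed-∷ x xs = trans (∑ˡ-++ _ (sublists xs) _) (cong (signed xs +ᶻ_) (begin
      ∑ˡ (map (x ∷_) (sublists xs)) (λ E → ⟦ All.all? P? E ⟧ *ᶻ sgn E)
        ≡⟨ ∑ˡ-map (x ∷_) _ (sublists xs) ⟩
      ∑ˡ (sublists xs) (λ E → ⟦ All.all? P? (x ∷ E) ⟧ *ᶻ (-1ℤ *ᶻ sgn E))
        ≡⟨ ∑ˡ-cong (sublists xs) (λ {E} _ → trans
             (cong (_*ᶻ (-1ℤ *ᶻ sgn E)) (⟦⟧-× (P? x) (All.all? P? E)))
             (rearrange ⟦ P? x ⟧ ⟦ All.all? P? E ⟧ (sgn E))) ⟩
      ∑ˡ (sublists xs) (λ E → ⟦ P? x ⟧ *ᶻ -1ℤ *ᶻ (⟦ All.all? P? E ⟧ *ᶻ sgn E))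
        ≡⟨ ∑ˡ-*ˡ (⟦ P? x ⟧ *ᶻ -1ℤ) _ (sublists xs) ⟩
      ⟦ P? x ⟧ *ᶻ -1ℤ *ᶻ signed xs
        ≡⟨ ℤ.*-assoc ⟦ P? x ⟧ -1ℤ (signed xs) ⟩
      ⟦ P? x ⟧ *ᶻ (-1ℤ *ᶻ signed xs) ∎))
      where
      open ≡-Reasoning
      rearrange : ∀ a b c → a *ᶻ b *ᶻ (-1ℤ *ᶻ c) ≡ a *ᶻ -1ℤ *ᶻ (b *ᶻ c)
      rearrange = solve-∀

    signed-accept : ∀ {x} xs → P x → signed (x ∷ xs) ≡ 0ℤ
    signed-accept {x} xs px = begin
      signed (x ∷ xs)                                ≡⟨ signed-∷ x xs ⟩
      signed xs +ᶻ ⟦ P? x ⟧ *ᶻ (-1ℤ *ᶻ signed xs)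
        ≡⟨ cong (λ c → signed xs +ᶻ c *ᶻ (-1ℤ *ᶻ signed xs)) (⟦⟧-true (P? x) px) ⟩
      signed xs +ᶻ 1ℤ *ᶻ (-1ℤ *ᶻ signed xs)          ≡⟨ cancel (signed xs) ⟩
      0ℤ                                             ∎
      where
      open ≡-Reasoning
      cancel : ∀ a → a +ᶻ 1ℤ *ᶻ (-1ℤ *ᶻ a) ≡ 0ℤ
      cancel = solve-∀

    signed-reject : ∀ {x} xs → ¬ P x → signed (x ∷ xs) ≡ signed xs
    signed-reject {x} xs ¬px = begin
      signed (x ∷ xs)                                ≡⟨ signed-∷ x xs ⟩
      signed xs +ᶻ ⟦ P? x ⟧ *ᶻ (-1ℤ *ᶻ signed xs)
        ≡⟨ cong (λ c → signed xs +ᶻ c *ᶻ (-1ℤ *ᶻ signed xs)) (⟦⟧-false (P? x) ¬px) ⟩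
      signed xs +ᶻ 0ℤ                                ≡⟨ ℤ.+-identityʳ _ ⟩
      signed xs                                      ∎
      where open ≡-Reasoning

  -- This is the expansion of (1 - 1)^m, where m entries of `xs` satisfy `P`. An entry failing `P`
  -- only adds sublists of weight 0; an entry satisfying it pairs each sublist without it with one
  -- of opposite sign.
  ∑-signed-sublists : (xs : List A) →
    ∑ˡ (sublists xs) (λ E → ⟦ All.all? P? E ⟧ *ᶻ sgn E) ≡ ⟦ ¬? (Any.any? P? xs) ⟧
  ∑-signed-sublists []       = refl
  ∑-signed-sublists (x ∷ xs) = step (P? x)
    where
    none? = ¬? (Any.any? P? (x ∷ xs))
    step : Dec (P x) → signed (x ∷ xs) ≡ ⟦ none? ⟧
    step (yes px) = trans (signed-accept xs px) (sym (⟦⟧-false none? (λ none → none (here px))))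
    step (no ¬px) = trans (signed-reject xs ¬px) (trans (∑-signed-sublists xs)
      (⟦⟧-cong (¬? (Any.any? P? xs)) none?
        (λ { none (here px) → ¬px px ; none (there any) → none any })
        (λ none → none ∘ there)))

independent⇒no-edge : (G : Graph n) {S : Subset n} → IsIndependent G S → ¬ Any (_∈² S) (edges G)
independent⇒no-edge G ind any with _ , ij∈ , i∈S , j∈S ← find any =
  ind _ _ i∈S j∈S (proj₂ (∈-edges⁻ G ij∈))

no-edge⇒independent : (G : Graph n) {S : Subset n} → ¬ Any (_∈² S) (edges G) → IsIndependent G S
no-edge⇒independent G none i j i∈S j∈S i~j with Fin.<-cmp i j
... | tri< i<j _ _ = none (lose (∈-edges⁺ G i<j i~j) (i∈S , j∈S))
... | tri≈ _ i≡j _ = Graph.irreflexive G i≡j i~j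
... | tri> _ _ j<i = none (lose (∈-edges⁺ G j<i (Graph.symmetric G i~j)) (j∈S , i∈S))

independentSets-∑ˡ : (k : ℕ) (G : Graph n) → + independentSets k G ≡
  ∑ˡ (sublists (edges G)) (λ E → sgn E *ᶻ ∑ˡ (subsets n) (λ S → ⟦ superset? k (vertices E) S ⟧))
independentSets-∑ˡ {n} k G = begin
  + independentSets k G
    ≡⟨ count-∑ˡ _ Ss ⟩
  ∑ˡ Ss (λ S → ⟦ (∣ S ∣ ℕ.≟ k) ×-dec isIndependent? G S ⟧)
    ≡⟨ ∑ˡ-cong Ss (λ {S} _ → expand S) ⟩
  ∑ˡ Ss (λ S → ∑ˡ Es (λ E → sgn E *ᶻ ⟦ superset? k (vertices E) S ⟧))
    ≡⟨ ∑ˡ-swap _ Ss Es ⟩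
  ∑ˡ Es (λ E → ∑ˡ Ss (λ S → sgn E *ᶻ ⟦ superset? k (vertices E) S ⟧))
    ≡⟨ ∑ˡ-cong Es (λ {E} _ → ∑ˡ-*ˡ (sgn E) _ Ss) ⟩
  ∑ˡ Es (λ E → sgn E *ᶻ ∑ˡ Ss (λ S → ⟦ superset? k (vertices E) S ⟧)) ∎
  where
  open ≡-Reasoning
  Ss = subsets n
  Es = sublists (edges G)
  expand : ∀ S → ⟦ (∣ S ∣ ℕ.≟ k) ×-dec isIndependent? G S ⟧ ≡
                 ∑ˡ Es (λ E → sgn E *ᶻ ⟦ superset? k (vertices E) S ⟧)
  expand S = begin
    ⟦ size? ×-dec isIndependent? G S ⟧
      ≡⟨ ⟦⟧-× size? (isIndependent? G S) ⟩
    ⟦ size? ⟧ *ᶻ ⟦ isIndependent? G S ⟧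
      ≡⟨ cong (⟦ size? ⟧ *ᶻ_) (⟦⟧-cong (isIndependent? G S) (¬? (Any.any? (_∈²? S) (edges G)))
           (independent⇒no-edge G) (no-edge⇒independent G)) ⟩
    ⟦ size? ⟧ *ᶻ ⟦ ¬? (Any.any? (_∈²? S) (edges G)) ⟧
      ≡⟨ cong (⟦ size? ⟧ *ᶻ_) (∑-signed-sublists (_∈²? S) (edges G)) ⟨
    ⟦ size? ⟧ *ᶻ ∑ˡ Es (λ E → ⟦ All.all? (_∈²? S) E ⟧ *ᶻ sgn E)
      ≡⟨ ∑ˡ-*ˡ ⟦ size? ⟧ _ Es ⟨
    ∑ˡ Es (λ E → ⟦ size? ⟧ *ᶻ (⟦ All.all? (_∈²? S) E ⟧ *ᶻ sgn E))
      ≡⟨ ∑ˡ-cong Es (λ {E} _ → term E) ⟩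
    ∑ˡ Es (λ E → sgn E *ᶻ ⟦ superset? k (vertices E) S ⟧) ∎
    where
    size? = ∣ S ∣ ℕ.≟ k
    term : ∀ E → ⟦ size? ⟧ *ᶻ (⟦ All.all? (_∈²? S) E ⟧ *ᶻ sgn E) ≡
                 sgn E *ᶻ ⟦ superset? k (vertices E) S ⟧
    term E = begin
      ⟦ size? ⟧ *ᶻ (⟦ All.all? (_∈²? S) E ⟧ *ᶻ sgn E)
        ≡⟨ cong (λ c → ⟦ size? ⟧ *ᶻ (c *ᶻ sgn E))
             (⟦⟧-cong (All.all? (_∈²? S) E) (vertices E ⊆? S)
                      (vertices-⊆ E) (λ V⊆S → All-vertices E V⊆S)) ⟩
      ⟦ size? ⟧ *ᶻ (⟦ vertices E ⊆? S ⟧ *ᶻ sgn E)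
        ≡⟨ rearrange ⟦ size? ⟧ ⟦ vertices E ⊆? S ⟧ (sgn E) ⟩
      sgn E *ᶻ (⟦ size? ⟧ *ᶻ ⟦ vertices E ⊆? S ⟧)
        ≡⟨ cong (sgn E *ᶻ_) (⟦⟧-× size? (vertices E ⊆? S)) ⟨
      sgn E *ᶻ ⟦ superset? k (vertices E) S ⟧ ∎
      where
      rearrange : ∀ a b c → a *ᶻ (b *ᶻ c) ≡ c *ᶻ (a *ᶻ b)
      rearrange = solve-∀

-- The identity for independent sets

module _ {n : ℕ} (G : Graph n) (k : ℕ) where

  private
    Es : List (List (Fin n × Fin n))
    Es = sublists (edges G)

    coeff : ℕ → ℕ → ℤ
    coeff v e = (-1ℤ ^ᶻ e) *ᶻ + ((n ∸ v) C (k ∸ v))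

    has? : (E : List (Fin n × Fin n)) (v e : ℕ) → Dec (∣ vertices E ∣ ≡ v × length E ≡ e)
    has? E v e = (∣ vertices E ∣ ℕ.≟ v) ×-dec (length E ℕ.≟ e)

    _≟[] : (E : List (Fin n × Fin n)) → Dec (E ≡ [])
    E ≟[] = List.≡-dec _≟ᴾ_ E []

    -- The contribution of a single edge set to the double sum once every σ is expanded over edge
    -- sets. Only the term with v = |V(E)| and e = |E| can be nonzero.
    total : List (Fin n × Fin n) → ℤ
    total E = ∑[ 2 ≤ v ≤ k ] ∑[ ⌈ v /2⌉ ≤ e ≤ v C 2 ] ⟦ has? E v e ⟧ *ᶻ coeff v e

    edgeTotal : List (Fin n × Fin n) → ℕ → ℤ
    edgeTotal E v = ∑[ ⌈ v /2⌉ ≤ e ≤ v C 2 ] ⟦ length E ℕ.≟ e ⟧ *ᶻ coeff v e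

    -- Separates the two conditions in `has?`, so that the outer sum can be collapsed at v before
    -- the inner one, whose limits depend on v.
    total-factor : ∀ E → total E ≡ (∑[ 2 ≤ v ≤ k ] ⟦ ∣ vertices E ∣ ℕ.≟ v ⟧ *ᶻ edgeTotal E v)
    total-factor E = ∑ˡ-cong (upTo (suc k ∸ 2)) (λ {i} _ → factor (2 + i))
      where
      factor : ∀ v → (∑[ ⌈ v /2⌉ ≤ e ≤ v C 2 ] ⟦ has? E v e ⟧ *ᶻ coeff v e)
                     ≡ ⟦ ∣ vertices E ∣ ℕ.≟ v ⟧ *ᶻ edgeTotal E v
      factor v = trans
        (∑ˡ-cong es (λ {i} _ → split (⌈ v /2⌉ + i)))
        (∑ˡ-*ˡ ⟦ ∣ vertices E ∣ ℕ.≟ v ⟧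
               (λ i → ⟦ length E ℕ.≟ ⌈ v /2⌉ + i ⟧ *ᶻ coeff v (⌈ v /2⌉ + i)) es)
        where
        es = upTo (suc (v C 2) ∸ ⌈ v /2⌉)
        split : ∀ e → ⟦ has? E v e ⟧ *ᶻ coeff v e ≡
                      ⟦ ∣ vertices E ∣ ℕ.≟ v ⟧ *ᶻ (⟦ length E ℕ.≟ e ⟧ *ᶻ coeff v e)
        split e = trans
          (cong (_*ᶻ coeff v e) (⟦⟧-× (∣ vertices E ∣ ℕ.≟ v) (length E ℕ.≟ e)))
          (ℤ.*-assoc ⟦ ∣ vertices E ∣ ℕ.≟ v ⟧ _ _)

    total-∉ : ∀ E → ¬ (2 ≤ ∣ vertices E ∣ × ∣ vertices E ∣ ≤ k) → total E ≡ 0ℤ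
    total-∉ E ∉range = trans (total-factor E) (∑-fibre-∉ ∣ vertices E ∣ 2 k (edgeTotal E) ∉range)

    total-∈ : ∀ {E} → E ⊑ pairs n → 2 ≤ ∣ vertices E ∣ → ∣ vertices E ∣ ≤ k →
              total E ≡ coeff ∣ vertices E ∣ (length E)
    total-∈ {E} E⊑ 2≤v v≤k = begin
      total E                    ≡⟨ total-factor E ⟩
      _                          ≡⟨ ∑-fibre v 2 k (edgeTotal E) 2≤v v≤k ⟩
      edgeTotal E v              ≡⟨ ∑-fibre (length E) ⌈ v /2⌉ (v C 2) (coeff v)
                                      (⌈∣vertices∣/2⌉≤ E) (length≤∣vertices∣C2 E⊑) ⟩
      coeff v (length E)         ∎
      where
      open ≡-Reasoning
      v = ∣ vertices E ∣

    supersets : List (Fin n × Fin n) → ℤ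
    supersets E = ∑ˡ (subsets n) (λ S → ⟦ superset? k (vertices E) S ⟧)

    supersets-≤ : ∀ E → ∣ vertices E ∣ ≤ k →
                  supersets E ≡ + ((n ∸ ∣ vertices E ∣) C (k ∸ ∣ vertices E ∣))
    supersets-≤ E v≤k = trans
      (cong (λ l → ∑ˡ (subsets n) (λ S → ⟦ superset? l (vertices E) S ⟧)) (sym (ℕ.m+[n∸m]≡n v≤k)))
      (∑-superset (vertices E) (k ∸ ∣ vertices E ∣))

    -- The empty edge set has no endpoints, so every k-set contains them and `total []` vanishes. A
    -- nonempty one has at least two endpoints and is caught by the double sum, unless it has more
    -- than k.
    pointwise : ∀ {E} → E ⊑ pairs n →
                sgn E *ᶻ supersets E ≡ ⟦ E ≟[] ⟧ *ᶻ + (n C k) +ᶻ total E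
    pointwise {[]} _ = begin
      1ℤ *ᶻ supersets []                       ≡⟨ ℤ.*-identityˡ _ ⟩
      supersets []                             ≡⟨ supersets-≤ [] (subst (_≤ k) (sym v≡0) z≤n) ⟩
      + ((n ∸ ∣ ⊥ {n} ∣) C (k ∸ ∣ ⊥ {n} ∣))    ≡⟨ cong (λ v → + ((n ∸ v) C (k ∸ v))) v≡0 ⟩
      + (n C k)                                ≡⟨ ℤ.*-identityˡ (+ (n C k)) ⟨
      1ℤ *ᶻ + (n C k)                          ≡⟨ ℤ.+-identityʳ _ ⟨
      1ℤ *ᶻ + (n C k) +ᶻ 0ℤ
        ≡⟨ cong (1ℤ *ᶻ + (n C k) +ᶻ_) (total-∉ [] λ (2≤v , _) → 2≰0 (subst (2 ≤_) v≡0 2≤v)) ⟨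
      1ℤ *ᶻ + (n C k) +ᶻ total []              ∎
      where
      open ≡-Reasoning
      v≡0 : ∣ ⊥ {n} ∣ ≡ 0
      v≡0 = Subset.∣⊥∣≡0 n
      2≰0 : ¬ (2 ≤ 0)
      2≰0 ()
    pointwise {E@(_ ∷ _)} E⊑ = trans nonempty (sym (ℤ.+-identityˡ (total E)))
      where
      nonempty : sgn E *ᶻ supersets E ≡ total E
      nonempty with ∣ vertices E ∣ ℕ.≤? k
      ... | yes v≤k = trans (cong (sgn E *ᶻ_) (supersets-≤ E v≤k))
                            (sym (total-∈ E⊑ (2≤∣vertices∣ E⊑ λ ()) v≤k))
      -- No k-set contains the endpoints and the outer sum stops at k, so both sides are 0.
      ... | no v≰k = trans (cong (sgn E *ᶻ_) (∑-superset-> k (vertices E) (ℕ.≰⇒> v≰k)))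
                    (trans (ℤ.*-zeroʳ (sgn E)) (sym (total-∉ E (v≰k ∘ proj₂))))

    ∑-≟[] : ∑ˡ Es (λ E → ⟦ E ≟[] ⟧) ≡ 1ℤ
    ∑-≟[] = ∑ˡ-one _≟[]
      (unique⇒exclusive (λ _ _ E≡[] E′≡[] → trans E≡[] (sym E′≡[]))
                        (sublists-Unique (edges-Unique G)))
      (lose (⊑⇒∈sublists (⊑-minimum (edges G))) refl)

    σ-term : ∀ v e → coeff v e *ᶻ + σ v e G ≡ ∑ˡ Es (λ E → ⟦ has? E v e ⟧ *ᶻ coeff v e)
    σ-term v e = begin
      coeff v e *ᶻ + σ v e G                       ≡⟨ cong (coeff v e *ᶻ_) (σ-∑ˡ G v e) ⟩
      coeff v e *ᶻ ∑ˡ Es (λ E → ⟦ has? E v e ⟧)    ≡⟨ ℤ.*-comm (coeff v e) _ ⟩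
      ∑ˡ Es (λ E → ⟦ has? E v e ⟧) *ᶻ coeff v e    ≡⟨ ∑ˡ-*ʳ (coeff v e) _ Es ⟨
      ∑ˡ Es (λ E → ⟦ has? E v e ⟧ *ᶻ coeff v e)    ∎
      where open ≡-Reasoning

    ∑-total : ∑ˡ Es total ≡
              (∑[ 2 ≤ v ≤ k ] ∑[ ⌈ v /2⌉ ≤ e ≤ v C 2 ] coeff v e *ᶻ + σ v e G)
    ∑-total = trans (∑ˡ-swap (λ E i → edgeSum E (2 + i)) Es (upTo (suc k ∸ 2)))
                    (∑ˡ-cong (upTo (suc k ∸ 2)) (λ {i} _ → inner (2 + i)))
      where
      edgeSum : List (Fin n × Fin n) → ℕ → ℤ
      edgeSum E v = ∑[ ⌈ v /2⌉ ≤ e ≤ v C 2 ] ⟦ has? E v e ⟧ *ᶻ coeff v e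
      inner : ∀ v → ∑ˡ Es (λ E → edgeSum E v) ≡ (∑[ ⌈ v /2⌉ ≤ e ≤ v C 2 ] coeff v e *ᶻ + σ v e G)
      inner v = trans
        (∑ˡ-swap (λ E i → ⟦ has? E v (⌈ v /2⌉ + i) ⟧ *ᶻ coeff v (⌈ v /2⌉ + i)) Es es)
        (∑ˡ-cong es (λ {i} _ → sym (σ-term v (⌈ v /2⌉ + i))))
        where es = upTo (suc (v C 2) ∸ ⌈ v /2⌉)

  independentSets-σ : + independentSets k G ≡ + (n C k) +ᶻ
    (∑[ 2 ≤ v ≤ k ] ∑[ ⌈ v /2⌉ ≤ e ≤ v C 2 ] coeff v e *ᶻ + σ v e G)
  independentSets-σ = begin
    + independentSets k G
      ≡⟨ independentSets-∑ˡ k G ⟩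
    ∑ˡ Es (λ E → sgn E *ᶻ supersets E)
      ≡⟨ ∑ˡ-cong Es (λ E∈ → pointwise (⊑-trans (∈sublists⇒⊑ E∈) (edges-⊑ G))) ⟩
    ∑ˡ Es (λ E → ⟦ E ≟[] ⟧ *ᶻ + (n C k) +ᶻ total E)
      ≡⟨ ∑ˡ-+ (λ E → ⟦ E ≟[] ⟧ *ᶻ + (n C k)) total Es ⟩
    ∑ˡ Es (λ E → ⟦ E ≟[] ⟧ *ᶻ + (n C k)) +ᶻ ∑ˡ Es total
      ≡⟨ cong₂ _+ᶻ_
           (trans (∑ˡ-*ʳ (+ (n C k)) (λ E → ⟦ E ≟[] ⟧) Es)
           (trans (cong (_*ᶻ + (n C k)) ∑-≟[]) (ℤ.*-identityˡ (+ (n C k)))))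
           ∑-total ⟩
    + (n C k) +ᶻ (∑[ 2 ≤ v ≤ k ] ∑[ ⌈ v /2⌉ ≤ e ≤ v C 2 ] coeff v e *ᶻ + σ v e G) ∎
    where open ≡-Reasoning

-- The identity for cliques

complete : {E : List (Fin n × Fin n)} → E ⊑ pairs n → length E ≡ ∣ vertices E ∣ C 2 →
           ∀ {e} → e ∈ pairs n → e ∈² vertices E → e ∈ E
complete {n} {E} E⊑ full {e} e∈pairs e∈²V with e ∈ᴱ? E
  where open DecMembership (_≟ᴾ_ {n}) using () renaming (_∈?_ to _∈ᴱ?_)
... | yes e∈E = e∈E
-- Adding `e` to `E` would give more distinct pairs inside `vertices E` than there are.
... | no  e∉E = contradiction too-long
  (ℕ.<-irrefl (trans full (sym (count-pairs-inside (vertices E)))))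
  where
  included : ∀ {e′} → e′ ∈ e ∷ E → e′ ∈ filter (_∈²? vertices E) (pairs n)
  included (here refl) = ∈-filter⁺ (_∈²? vertices E) e∈pairs e∈²V
  included (there e′∈E) =
    ∈-filter⁺ (_∈²? vertices E) (⊑-lookup E⊑ e′∈E) (All.lookup (All-vertices E id) e′∈E)
  too-long : length E < count (_∈²? vertices E) (pairs n)
  too-long = length-⊆
    (All.tabulate (λ e′∈E e≡e′ → e∉E (subst (_∈ E) (sym e≡e′) e′∈E)) ∷ ⊑-Unique E⊑ (pairs-Unique n))
    included

-- Supplies the second endpoint of an edge at each vertex of a clique, so that every vertex of the
-- clique is recovered from its edges.
another-element : {S : Subset n} {x : Fin n} → x ∈ₛ S → ∣ S ∣ ≢ 1 → ∃ λ y → y ∈ₛ S × x ≢ y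
another-element {S = S} {x} x∈S ∣S∣≢1 with Fin.any? (λ y → (y ∈? S) ×-dec ¬? (x Fin.≟ y))
... | yes found = found
... | no  none  = contradiction (trans (cong ∣_∣ S≡⁅x⁆) (Subset.∣⁅x⁆∣≡1 x)) ∣S∣≢1
  where
  S⊆⁅x⁆ : S ⊆ₛ ⁅ x ⁆
  S⊆⁅x⁆ {y} y∈S with x Fin.≟ y
  ... | yes refl = Subset.x∈⁅x⁆ x
  ... | no  x≢y  = contradiction (y , y∈S , x≢y) none
  S≡⁅x⁆ : S ≡ ⁅ x ⁆
  S≡⁅x⁆ = Subset.⊆-antisym S⊆⁅x⁆
    (λ y∈⁅x⁆ → subst (_∈ₛ S) (sym (Subset.x∈⁅y⁆⇒x≡y x y∈⁅x⁆)) x∈S)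

module _ {n : ℕ} (G : Graph n) (k : ℕ) where

  private
    Es : List (List (Fin n × Fin n))
    Es = sublists (edges G)

    Full : List (Fin n × Fin n) → Set
    Full E = ∣ vertices E ∣ ≡ k × length E ≡ k C 2

    full? : U.Decidable Full
    full? E = (∣ vertices E ∣ ℕ.≟ k) ×-dec (length E ℕ.≟ k C 2)

    Full-complete : ∀ {E} → E ∈ Es → Full E → ∀ {e} → e ∈ pairs n → e ∈² vertices E → e ∈ E
    Full-complete E∈ (∣V∣≡k , ∣E∣≡) =
      complete (⊑-trans (∈sublists⇒⊑ E∈) (edges-⊑ G)) (trans ∣E∣≡ (cong (_C 2) (sym ∣V∣≡k)))

    -- Used in both directions, this shows that the vertex set determines a full edge set.
    Full-⊆ : ∀ {E E′} → E ∈ Es → E′ ∈ Es → vertices E ≡ vertices E′ → Full E′ →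
             ∀ {e} → e ∈ E → e ∈ E′
    Full-⊆ {E} E∈ E′∈ V≡V′ full′ e∈E = Full-complete E′∈ full′
      (⊑-lookup (⊑-trans (∈sublists⇒⊑ E∈) (edges-⊑ G)) e∈E)
      (subst (_ ∈²_) V≡V′ (All.lookup (All-vertices E id) e∈E))

    Full-clique : ∀ {E} → E ∈ Es → Full E → IsClique G (vertices E)
    Full-clique E∈ full i j i∈V j∈V i≢j with Fin.<-cmp i j
    ... | tri< i<j _ _ = proj₂ (∈-edges⁻ G (⊑-lookup (∈sublists⇒⊑ E∈)
                           (Full-complete E∈ full (∈-pairs⁺ i<j) (i∈V , j∈V))))
    ... | tri≈ _ i≡j _ = contradiction i≡j i≢j
    ... | tri> _ _ j<i = Graph.symmetric G (proj₂ (∈-edges⁻ G (⊑-lookup (∈sublists⇒⊑ E∈)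
                           (Full-complete E∈ full (∈-pairs⁺ j<i) (j∈V , i∈V)))))

    module CliqueEdges {S : Subset n}
                       (∣S∣≡k : ∣ S ∣ ≡ k) (clique : IsClique G S) (k≢1 : k ≢ 1) where

      E : List (Fin n × Fin n)
      E = filter (_∈²? S) (edges G)

      E∈ : E ∈ Es
      E∈ = ⊑⇒∈sublists (filter-⊆ (_∈²? S) (edges G))

      V≡S : vertices E ≡ S
      V≡S = Subset.⊆-antisym (vertices-⊆ E (All.all-filter (_∈²? S) (edges G))) S⊆V
        where
        S⊆V : S ⊆ₛ vertices E
        S⊆V {x} x∈S with y , y∈S , x≢y ← another-element x∈S (k≢1 ∘ trans (sym ∣S∣≡k))
          with x~y ← clique x y x∈S y∈S x≢y | Fin.<-cmp x y
        ... | tri< x<y _ _ = ∈-vertices⁺ (inj₁ (∈-filter⁺ (_∈²? S)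
                               (∈-edges⁺ G x<y x~y) (x∈S , y∈S)))
        ... | tri≈ _ x≡y _ = contradiction x≡y x≢y
        ... | tri> _ _ y<x = ∈-vertices⁺ (inj₂ (∈-filter⁺ (_∈²? S)
                               (∈-edges⁺ G y<x (Graph.symmetric G x~y)) (y∈S , x∈S)))

      -- Every pair inside a clique is an edge of G, so restricting `edges G` or `pairs n` to `S`
      -- yields the same members.
      ∣E∣≡ : length E ≡ k C 2
      ∣E∣≡ = trans
        (ℕ.≤-antisym
          (length-⊆ (Unique.filter⁺ (_∈²? S) (edges-Unique G)) E⊆)
          (length-⊆ (Unique.filter⁺ (_∈²? S) (pairs-Unique n)) ⊆E))
        (trans (count-pairs-inside S) (cong (_C 2) ∣S∣≡k))
        where
        E⊆ : ∀ {e} → e ∈ E → e ∈ filter (_∈²? S) (pairs n)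
        E⊆ e∈ with e∈edges , e∈²S ← ∈-filter⁻ (_∈²? S) {xs = edges G} e∈ =
          ∈-filter⁺ (_∈²? S) (⊑-lookup (edges-⊑ G) e∈edges) e∈²S
        ⊆E : ∀ {e} → e ∈ filter (_∈²? S) (pairs n) → e ∈ E
        ⊆E e∈ with e∈pairs , i∈S , j∈S ← ∈-filter⁻ (_∈²? S) {xs = pairs n} e∈
          with i<j ← ∈-pairs⁻ e∈pairs =
          ∈-filter⁺ (_∈²? S) (∈-edges⁺ G i<j (clique _ _ i∈S j∈S (Fin.<⇒≢ i<j))) (i∈S , j∈S)

      full : Full E
      full = trans (cong ∣_∣ V≡S) ∣S∣≡k , ∣E∣≡

  -- A double count of the pairs (S, E) with S = V(E) and E full: each clique S of order k occurs
  -- once, and so does each full E. For k = 1 the left side is n, while `classes 1 0` is empty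
  -- because a single vertex is isolated.
  cliques-σ : k ≢ 1 → cliques k G ≡ σ k (k C 2) G
  cliques-σ k≢1 = ℤ.+-injective (begin
    + cliques k G
      ≡⟨ count-∑ˡ clique? Ss ⟩
    ∑ˡ Ss (λ S → ⟦ clique? S ⟧)
      ≡⟨ ∑ˡ-cong Ss (λ {S} _ → sym (one-edge-set S)) ⟩
    ∑ˡ Ss (λ S → ∑ˡ Es (λ E → ⟦ (S ≟ˢ vertices E) ×-dec full? E ⟧))
      ≡⟨ ∑ˡ-swap _ Ss Es ⟩
    ∑ˡ Es (λ E → ∑ˡ Ss (λ S → ⟦ (S ≟ˢ vertices E) ×-dec full? E ⟧))
      ≡⟨ ∑ˡ-cong Es (λ {E} _ → ∑-subsets-≟ (vertices E) (full? E)) ⟩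
    ∑ˡ Es (λ E → ⟦ full? E ⟧)
      ≡⟨ σ-∑ˡ G k (k C 2) ⟨
    + σ k (k C 2) G ∎)
    where
    open ≡-Reasoning
    Ss = subsets n
    clique? : (S : Subset n) → Dec (∣ S ∣ ≡ k × IsClique G S)
    clique? S = (∣ S ∣ ℕ.≟ k) ×-dec isClique? G S
    one-edge-set : ∀ S → ∑ˡ Es (λ E → ⟦ (S ≟ˢ vertices E) ×-dec full? E ⟧) ≡ ⟦ clique? S ⟧
    one-edge-set S = ∑ˡ-exclusive (λ E → (S ≟ˢ vertices E) ×-dec full? E) (clique? S)
      (unique⇒exclusive
        (λ {E} {E′} E∈ E′∈ (S≡V , full) (S≡V′ , full′) →
          let V≡V′ = trans (sym S≡V) S≡V′ in
          ⊑-ext (edges-Unique G) (∈sublists⇒⊑ E∈) (∈sublists⇒⊑ E′∈)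
            (Full-⊆ E∈ E′∈ V≡V′ full′) (Full-⊆ E′∈ E∈ (sym V≡V′) full))
        (sublists-Unique (edges-Unique G)))
      (λ (∣S∣≡k , clique) → let open CliqueEdges ∣S∣≡k clique k≢1 in lose E∈ (sym V≡S , full))
      (λ any → let E , E∈ , S≡V , full = find any in
        trans (cong ∣_∣ S≡V) (proj₁ full) , subst (IsClique G) (sym S≡V) (Full-clique E∈ full))

proposition15 : ∀ {n : ℕ} (G : Graph n) (k : ℕ) → k ≤ n →
    (+ independentSets k G
       ≡ + (n C k) +ᶻ
         (∑[ 2 ≤ v ≤ k ] ∑[ ⌈ v /2⌉ ≤ e ≤ v C 2 ]
           (-1ℤ ^ᶻ e) *ᶻ + ((n ∸ v) C (k ∸ v)) *ᶻ + σ v e G))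
    × (k ≢ 1 → cliques k G ≡ σ k (k C 2) G)
proposition15 G k _ = independentSets-σ G k , cliques-σ G k
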